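{- Let $m$ be a positive integer such that $m^2+4$ is square-free. If $h(m^2+4)=1$, then $m=1$ or $m$ is a prime number.
   Context: For a square-free integer $d>1$, $h(d)$ denotes the class number of the real quadratic field $\mathbb{Q}(\sqrt d)$. -}

module Defs where

open import Data.Fin.Base using (Fin)
open import Data.Integer.Base as ℤ using (ℤ; +_)
open import Data.List.Base using (List; []; _∷_; map)
open import Data.List.Properties using (map-cong; map-id; map-∘)
open import Data.List.Relation.Unary.Any using (Any; here; there)
open import Data.Nat.Base as ℕ using (ℕ)
open import Data.Nat.Divisibility using (_∣_)
open import Data.Product using (∃; _×_; _,_)
open import Data.Rational.Base as ℚ using (ℚ; 0ℚ; 1ℚ)
open import Data.Rational.Solver using (module +-*-Solver)
open import Function.Bundles using (_⇔_; mk⇔; Equivalence; Inverse)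
open import Level using (0ℓ)
open import Relation.Binary.Bundles using (Setoid)
open import Relation.Binary.PropositionalEquality
  using (_≡_; _≢_; refl; sym; trans; cong; cong₂; subst; setoid)

SquareFree : ℕ → Set
SquareFree n = ∀ k → (k ℕ.* k) ∣ n → k ≡ 1

ℤ→ℚ : ℤ → ℚ
ℤ→ℚ i = i ℚ./ 1

-- ℚ(√d) is presented as pairs a +√ b standing for a + b√d, i.e. as
-- ℚ[X]/(X² - d).  This is the quadratic field when d is not a perfect square,
-- in particular for square-free d > 1, the only case of interest.

module QuadraticField (d : ℕ) where

  infix  8 _+√_
  infixl 7 _*_ _·_
  infixl 6 _+_
  infix  4 _∈⟨_⟩ _∈_ _≈_ _∼_

  record K : Set where
    constructor _+√_
    field
      rat irr : ℚ

  δ : ℚ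
  δ = ℤ→ℚ (+ d)

  _+_ : K → K → K
  (a +√ b) + (a′ +√ b′) = (a ℚ.+ a′) +√ (b ℚ.+ b′)

  _*_ : K → K → K
  (a +√ b) * (a′ +√ b′) =
    (a ℚ.* a′ ℚ.+ δ ℚ.* (b ℚ.* b′)) +√ (a ℚ.* b′ ℚ.+ b ℚ.* a′)

  0K 1K : K
  0K = 0ℚ +√ 0ℚ
  1K = 1ℚ +√ 0ℚ

  ℤ→K : ℤ → K
  ℤ→K i = ℤ→ℚ i +√ 0ℚ

  -- [c₀, …, cₙ₋₁] denotes the monic polynomial c₀ + c₁X + ⋯ + cₙ₋₁Xⁿ⁻¹ + Xⁿ.

  evalMonic : List ℤ → K → K
  evalMonic []       α = 1K
  evalMonic (c ∷ cs) α = ℤ→K c + α * evalMonic cs α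

  -- The ring of integers 𝓞: elements of K integral over ℤ.

  Integral : K → Set
  Integral α = ∃ λ cs → evalMonic cs α ≡ 0K

  -- α ∈⟨ g₁ ∷ … ∷ gₙ ∷ [] ⟩ : α = r₁g₁ + ⋯ + rₙgₙ for some rᵢ in 𝓞.

  _∈⟨_⟩ : K → List K → Set
  α ∈⟨ []     ⟩ = α ≡ 0K
  α ∈⟨ g ∷ gs ⟩ =
    ∃ λ ρ → ∃ λ β → Integral ρ × β ∈⟨ gs ⟩ × α ≡ ρ * g + β

  -- A fractional ideal is a nonzero finitely generated 𝓞-submodule of K.  It is
  -- given by a list of generators; different lists may present the same ideal,
  -- equality of ideals being _≈_ below.

  record FractionalIdeal : Set where
    constructor ⟨_,_⟩
    field
      generators : List K
      nonzero    : Any (_≢ 0K) generators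

  open FractionalIdeal

  _∈_ : K → FractionalIdeal → Set
  α ∈ I = α ∈⟨ generators I ⟩

  _≈_ : FractionalIdeal → FractionalIdeal → Set
  I ≈ J = ∀ α → α ∈ I ⇔ α ∈ J

  -- Units of K, i.e. its nonzero elements when d is not a perfect square.

  record Kˣ : Set where
    field
      value inverse : K
      isInverse     : value * inverse ≡ 1K

  open Kˣ

  open +-*-Solver using (solve; con; _:=_) renaming (_:+_ to _⊕_; _:*_ to _⊗_)

  *-assoc : ∀ α β γ → (α * β) * γ ≡ α * (β * γ)
  *-assoc (a +√ b) (a′ +√ b′) (a″ +√ b″) = cong₂ _+√_
    (solve 7 (λ a b a′ b′ a″ b″ δ →
       (a ⊗ a′ ⊕ δ ⊗ (b ⊗ b′)) ⊗ a″ ⊕ δ ⊗ ((a ⊗ b′ ⊕ b ⊗ a′) ⊗ b″)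
       := a ⊗ (a′ ⊗ a″ ⊕ δ ⊗ (b′ ⊗ b″)) ⊕ δ ⊗ (b ⊗ (a′ ⊗ b″ ⊕ b′ ⊗ a″)))
       refl a b a′ b′ a″ b″ δ)
    (solve 7 (λ a b a′ b′ a″ b″ δ →
       (a ⊗ a′ ⊕ δ ⊗ (b ⊗ b′)) ⊗ b″ ⊕ (a ⊗ b′ ⊕ b ⊗ a′) ⊗ a″
       := a ⊗ (a′ ⊗ b″ ⊕ b′ ⊗ a″) ⊕ b ⊗ (a′ ⊗ a″ ⊕ δ ⊗ (b′ ⊗ b″)))
       refl a b a′ b′ a″ b″ δ)

  *-comm : ∀ α β → α * β ≡ β * α
  *-comm (a +√ b) (a′ +√ b′) = cong₂ _+√_
    (solve 5 (λ a b a′ b′ δ →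
       a ⊗ a′ ⊕ δ ⊗ (b ⊗ b′) := a′ ⊗ a ⊕ δ ⊗ (b′ ⊗ b)) refl a b a′ b′ δ)
    (solve 4 (λ a b a′ b′ →
       a ⊗ b′ ⊕ b ⊗ a′ := a′ ⊗ b ⊕ b′ ⊗ a) refl a b a′ b′)

  *-identityˡ : ∀ α → 1K * α ≡ α
  *-identityˡ (a +√ b) = cong₂ _+√_
    (solve 3 (λ a b δ →
       con 1ℚ ⊗ a ⊕ δ ⊗ (con 0ℚ ⊗ b) := a) refl a b δ)
    (solve 2 (λ a b → con 1ℚ ⊗ b ⊕ con 0ℚ ⊗ a := b) refl a b)

  *-distribˡ-+ : ∀ α β γ → α * (β + γ) ≡ α * β + α * γ
  *-distribˡ-+ (a +√ b) (a′ +√ b′) (a″ +√ b″) = cong₂ _+√_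
    (solve 7 (λ a b a′ b′ a″ b″ δ →
       a ⊗ (a′ ⊕ a″) ⊕ δ ⊗ (b ⊗ (b′ ⊕ b″))
       := (a ⊗ a′ ⊕ δ ⊗ (b ⊗ b′)) ⊕ (a ⊗ a″ ⊕ δ ⊗ (b ⊗ b″)))
       refl a b a′ b′ a″ b″ δ)
    (solve 6 (λ a b a′ b′ a″ b″ →
       a ⊗ (b′ ⊕ b″) ⊕ b ⊗ (a′ ⊕ a″)
       := (a ⊗ b′ ⊕ b ⊗ a′) ⊕ (a ⊗ b″ ⊕ b ⊗ a″))
       refl a b a′ b′ a″ b″)

  *-zeroʳ : ∀ α → α * 0K ≡ 0K
  *-zeroʳ (a +√ b) = cong₂ _+√_
    (solve 3 (λ a b δ →
       a ⊗ con 0ℚ ⊕ δ ⊗ (b ⊗ con 0ℚ) := con 0ℚ) refl a b δ)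
    (solve 2 (λ a b → a ⊗ con 0ℚ ⊕ b ⊗ con 0ℚ := con 0ℚ) refl a b)

  cancel : ∀ x y → x * y ≡ 1K → ∀ α → y * (x * α) ≡ α
  cancel x y xy≡1 α =
    trans (sym (*-assoc y x α))
      (trans (cong (_* α) (trans (*-comm y x) xy≡1)) (*-identityˡ α))

  scale-≢0 : (x : Kˣ) → ∀ {α} → α ≢ 0K → value x * α ≢ 0K
  scale-≢0 x {α} α≢0 xα≡0 = α≢0
    (trans (sym (cancel (value x) (inverse x) (isInverse x) α))
      (trans (cong (inverse x *_) xα≡0) (*-zeroʳ (inverse x))))

  scale-Any : (x : Kˣ) → ∀ {gs} →
              Any (_≢ 0K) gs → Any (_≢ 0K) (map (value x *_) gs)
  scale-Any x (here g≢0)  = here (scale-≢0 x g≢0)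
  scale-Any x (there any) = there (scale-Any x any)

  -- The fractional ideal xI = { xα ∣ α ∈ I }.

  _·_ : Kˣ → FractionalIdeal → FractionalIdeal
  x · ⟨ gs , gs≢0 ⟩ = ⟨ map (value x *_) gs , scale-Any x gs≢0 ⟩

  -- I and J have the same class in the group of fractional ideals modulo
  -- principal ones: J = (x)I for some x.

  _∼_ : FractionalIdeal → FractionalIdeal → Set
  I ∼ J = ∃ λ x → (x · I) ≈ J

  scale-∈ : ∀ x gs {α} → α ∈⟨ gs ⟩ → (x * α) ∈⟨ map (x *_) gs ⟩
  scale-∈ x []       refl = *-zeroʳ x
  scale-∈ x (g ∷ gs) (ρ , β , int , β∈ , refl) =
    ρ , x * β , int , scale-∈ x gs β∈ ,
    trans (*-distribˡ-+ x (ρ * g) β)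
      (cong (_+ x * β)
        (trans (sym (*-assoc x ρ g))
          (trans (cong (_* g) (*-comm x ρ)) (*-assoc ρ x g))))

  unscale-list : ∀ x y → x * y ≡ 1K → ∀ gs → map (y *_) (map (x *_) gs) ≡ gs
  unscale-list x y xy gs =
    trans (sym (map-∘ gs)) (trans (map-cong (cancel x y xy) gs) (map-id gs))

  unscale-∈ : ∀ x y → x * y ≡ 1K → ∀ gs {α} →
              α ∈⟨ map (x *_) gs ⟩ → (y * α) ∈⟨ gs ⟩
  unscale-∈ x y xy gs {α} α∈ =
    subst ((y * α) ∈⟨_⟩) (unscale-list x y xy gs) (scale-∈ y (map (x *_) gs) α∈)

  open Equivalence using (to; from)

  ∼-refl : ∀ {I} → I ∼ I
  ∼-refl {I} = record { value = 1K ; inverse = 1K ; isInverse = *-identityˡ 1K }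
    , λ α → mk⇔ (subst (α ∈⟨_⟩) eq) (subst (α ∈⟨_⟩) (sym eq))
    where
    eq : map (1K *_) (generators I) ≡ generators I
    eq = trans (map-cong *-identityˡ (generators I)) (map-id (generators I))

  ∼-sym : ∀ {I J} → I ∼ J → J ∼ I
  ∼-sym {I} {J} (x , xI≈J) =
    record { value = iv ; inverse = v ; isInverse = iv*v }
    , λ α → mk⇔
        (λ α∈ → subst (_∈ I) (cancel v iv v*iv α)
                  (unscale-∈ v iv v*iv (generators I)
                    (from (xI≈J _) (unscale-∈ iv v iv*v (generators J) α∈))))
        (λ α∈ → subst (_∈⟨ map (iv *_) (generators J) ⟩) (cancel v iv v*iv α)
                  (scale-∈ iv (generators J)
                    (to (xI≈J _) (scale-∈ v (generators I) α∈))))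
    where
    v  = value x
    iv = inverse x
    v*iv : v * iv ≡ 1K
    v*iv = isInverse x
    iv*v : iv * v ≡ 1K
    iv*v = trans (*-comm iv v) v*iv

  ∼-trans : ∀ {I J L} → I ∼ J → J ∼ L → I ∼ L
  ∼-trans {I} {J} {L} (x , xI≈J) (y , yJ≈L) =
    record { value = vy * vx ; inverse = ix * iy ; isInverse = inv }
    , λ α → mk⇔
        (λ α∈ → to (yJ≈L α)
           (subst (_∈⟨ map (vy *_) (generators J) ⟩) (cancel iy vy iy*vy α)
             (scale-∈ vy (generators J) (to (xI≈J _)
               (unscale-∈ vy iy (isInverse y) (map (vx *_) (generators I))
                 (subst (α ∈⟨_⟩) list-eq α∈))))))
        (λ α∈ → subst (α ∈⟨_⟩) (sym list-eq)
           (subst (_∈⟨ map (vy *_) (map (vx *_) (generators I)) ⟩)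
             (cancel iy vy iy*vy α)
             (scale-∈ vy (map (vx *_) (generators I)) (from (xI≈J _)
               (unscale-∈ vy iy (isInverse y) (generators J)
                 (from (yJ≈L α) α∈))))))
    where
    vx = value x
    ix = inverse x
    vy = value y
    iy = inverse y
    iy*vy : iy * vy ≡ 1K
    iy*vy = trans (*-comm iy vy) (isInverse y)
    inv : (vy * vx) * (ix * iy) ≡ 1K
    inv = trans (*-assoc vy vx (ix * iy))
      (trans (cong (vy *_) (trans (sym (*-assoc vx ix iy))
        (trans (cong (_* iy) (isInverse x)) (*-identityˡ iy))))
        (isInverse y))
    list-eq : map ((vy * vx) *_) (generators I)
            ≡ map (vy *_) (map (vx *_) (generators I))
    list-eq = trans (map-cong (*-assoc vy vx) (generators I))
                (map-∘ (generators I))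

  idealClasses : Setoid 0ℓ 0ℓ
  idealClasses = record
    { Carrier       = FractionalIdeal
    ; _≈_           = _∼_
    ; isEquivalence = record
      { refl  = λ {I} → ∼-refl {I}
      ; sym   = λ {I} {J} → ∼-sym {I} {J}
      ; trans = λ {I} {J} {L} → ∼-trans {I} {J} {L}
      }
    }

-- ClassNumber d n says h(d) = n: the ideal classes of ℚ(√d) are in bijection
-- with Fin n.  A relation is used because h as a function would presuppose a
-- proof that the class group is finite.

ClassNumber : ℕ → ℕ → Set
ClassNumber d n = Inverse (setoid (Fin n)) (QuadraticField.idealClasses d)

{-# OPTIONS --safe #-}

-- Put ε = (m + √(m² + 4)) / 2, a unit with ε² = mε + 1.  As m² + 4 is square-free,
-- 𝓞 = ℤ[ε], and x + yε has norm x² + mxy − y².  Multiplying by ε⁻¹ is a step of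
-- Euclid's algorithm on (x, y), and the descent shows that a norm of absolute
-- value below m is, up to sign, a perfect square.  If m is composite, take a
-- prime p ∣ m with p < m.  As N(ε − 1) = −m, the ideal (p, ε − 1) has norm p, so
-- a generator of it would have norm ±p, which is not ± a square.

module Submission where

open import Defs
open import Data.Fin.Base using (Fin; zero)
open import Data.Integer.Base as ℤ using (ℤ; +_; -[1+_]; ∣_∣)
open import Data.Integer.Divisibility.Signed as ℤ using ()
import Data.Integer.Properties as ℤ
open import Data.Integer.Solver using () renaming (module +-*-Solver to ℤ-Solver)
open import Data.List.Base using (List; []; _∷_)
open import Data.List.Relation.Unary.All using (_∷_)
open import Data.List.Relation.Unary.Any using (here)
open import Data.Nat.Base as ℕ using (ℕ; zero; suc; s≤s; z≤n)
open import Data.Nat.Coprimality as Coprime using (Coprime; coprime-divisor)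
open import Data.Nat.Divisibility as ℕ using (_∣_; divides)
open import Data.Nat.Induction using (<-wellFounded)
open import Data.Nat.Primality
  using (Prime; Composite; composite; euclidsLemma; prime?; prime⇒irreducible;
         prime⇒nonZero; ¬composite⇒prime; ¬prime[0]; ¬prime[1])
open import Data.Nat.Primality.Factorisation using (factorise)
import Data.Nat.Properties as ℕ
open import Data.Nat.Solver using () renaming (module +-*-Solver to ℕ-Solver)
open import Data.Product.Base using (∃; ∃₂; _×_; _,_; proj₁; proj₂)
open import Data.Rational.Base as ℚ using (ℚ; 0ℚ; 1ℚ; ½; mkℚ; toℚᵘ)
import Data.Rational.Properties as ℚ
open import Data.Rational.Solver using (module +-*-Solver)
open import Data.Rational.Unnormalised.Base as ℚᵘ using (mkℚᵘ; *≡*)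
import Data.Rational.Unnormalised.Properties as ℚᵘ
open import Data.Sum.Base using (_⊎_; inj₁; inj₂; [_,_]′; reduce)
open import Function.Bundles using (Inverse; Equivalence; _⇔_)
open import Induction.WellFounded using (Acc; acc)
open import Relation.Binary.PropositionalEquality
open import Relation.Nullary using (yes; no; ¬_; contradiction)
open import Relation.Nullary.Decidable using (from-yes)

-- `Integral` supplies an arbitrary monic polynomial, of any degree and possibly reducible, so the
-- trace and norm of α cannot be read off its coefficients. Instead, α stabilises a finitely
-- generated ℤ-module containing 1. A common denominator D of that module makes D² N(α)ᵏ an integer
-- for every k, and this forces N(α) to be an integer. The trace is then N(α + 1) - N(α) - 1, and
-- square-freeness bounds the denominator of the coefficient of √d. The norm of a generator of (p, ε
-- - 1) is computed without a theory of ideal norms: a 2 × 2 determinant shows that it divides p,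
-- and a congruence modulo p shows that p divides it. The bound m in the descent is sharp when m is
-- not a square, because ε - 1 itself has norm -m. This is why the argument takes a prime divisor
-- strictly below m, and why it leaves prime m alone.

-- The embedding of ℤ in ℚ

toℚᵘ-ℤ→ℚ : ∀ i → toℚᵘ (ℤ→ℚ i) ℚᵘ.≃ mkℚᵘ i 0
toℚᵘ-ℤ→ℚ i = ℚ.toℚᵘ-fromℚᵘ (mkℚᵘ i 0)

ℤ→ℚ-+ : ∀ i j → ℤ→ℚ (i ℤ.+ j) ≡ ℤ→ℚ i ℚ.+ ℤ→ℚ j
ℤ→ℚ-+ i j = ℚ.toℚᵘ-injective (begin
  toℚᵘ (ℤ→ℚ (i ℤ.+ j))               ≈⟨ toℚᵘ-ℤ→ℚ (i ℤ.+ j) ⟩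
  mkℚᵘ (i ℤ.+ j) 0
    ≡⟨ cong (λ k → mkℚᵘ k 0) (cong₂ ℤ._+_ (ℤ.*-identityʳ i) (ℤ.*-identityʳ j)) ⟨
  mkℚᵘ i 0 ℚᵘ.+ mkℚᵘ j 0             ≈⟨ ℚᵘ.+-cong (toℚᵘ-ℤ→ℚ i) (toℚᵘ-ℤ→ℚ j) ⟨
  toℚᵘ (ℤ→ℚ i) ℚᵘ.+ toℚᵘ (ℤ→ℚ j)     ≈⟨ ℚ.toℚᵘ-homo-+ (ℤ→ℚ i) (ℤ→ℚ j) ⟨
  toℚᵘ (ℤ→ℚ i ℚ.+ ℤ→ℚ j)             ∎)
  where open ℚᵘ.≃-Reasoning

ℤ→ℚ-* : ∀ i j → ℤ→ℚ (i ℤ.* j) ≡ ℤ→ℚ i ℚ.* ℤ→ℚ j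
ℤ→ℚ-* i j = ℚ.toℚᵘ-injective (begin
  toℚᵘ (ℤ→ℚ (i ℤ.* j))               ≈⟨ toℚᵘ-ℤ→ℚ (i ℤ.* j) ⟩
  mkℚᵘ i 0 ℚᵘ.* mkℚᵘ j 0             ≈⟨ ℚᵘ.*-cong (toℚᵘ-ℤ→ℚ i) (toℚᵘ-ℤ→ℚ j) ⟨
  toℚᵘ (ℤ→ℚ i) ℚᵘ.* toℚᵘ (ℤ→ℚ j)     ≈⟨ ℚ.toℚᵘ-homo-* (ℤ→ℚ i) (ℤ→ℚ j) ⟨
  toℚᵘ (ℤ→ℚ i ℚ.* ℤ→ℚ j)             ∎)
  where open ℚᵘ.≃-Reasoning

ℤ→ℚ-neg : ∀ i → ℤ→ℚ (ℤ.- i) ≡ ℚ.- ℤ→ℚ i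
ℤ→ℚ-neg i = ℚ.toℚᵘ-injective (begin
  toℚᵘ (ℤ→ℚ (ℤ.- i))   ≈⟨ toℚᵘ-ℤ→ℚ (ℤ.- i) ⟩
  ℚᵘ.- mkℚᵘ i 0        ≈⟨ ℚᵘ.-‿cong (toℚᵘ-ℤ→ℚ i) ⟨
  ℚᵘ.- toℚᵘ (ℤ→ℚ i)    ≈⟨ ℚ.toℚᵘ-homo‿- (ℤ→ℚ i) ⟨
  toℚᵘ (ℚ.- ℤ→ℚ i)     ∎)
  where open ℚᵘ.≃-Reasoning

ℤ→ℚ-injective : ∀ {i j} → ℤ→ℚ i ≡ ℤ→ℚ j → i ≡ j
ℤ→ℚ-injective {i} {j} eq with ℚ./-injective-≃ (mkℚᵘ i 0) (mkℚᵘ j 0) eq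
... | *≡* i*1≡j*1 = ℤ.*-cancelʳ-≡ i j (+ 1) i*1≡j*1

clear-denominator : ∀ q → q ℚ.* ℤ→ℚ (ℚ.↧ q) ≡ ℤ→ℚ (ℚ.↥ q)
clear-denominator q@record{} = ℚ.toℚᵘ-injective (begin
  toℚᵘ (q ℚ.* ℤ→ℚ (ℚ.↧ q))             ≈⟨ ℚ.toℚᵘ-homo-* q (ℤ→ℚ (ℚ.↧ q)) ⟩
  toℚᵘ q ℚᵘ.* toℚᵘ (ℤ→ℚ (ℚ.↧ q))       ≈⟨ ℚᵘ.*-congˡ {toℚᵘ q} (toℚᵘ-ℤ→ℚ (ℚ.↧ q)) ⟩
  toℚᵘ q ℚᵘ.* mkℚᵘ (ℚ.↧ q) 0           ≈⟨ *≡* (trans (ℤ.*-identityʳ _) (cong (ℚ.↥ q ℤ.*_) (cong +_ (sym (ℕ.*-identityʳ _))))) ⟩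
  mkℚᵘ (ℚ.↥ q) 0                       ≈⟨ toℚᵘ-ℤ→ℚ (ℚ.↥ q) ⟨
  toℚᵘ (ℤ→ℚ (ℚ.↥ q))                   ∎)
  where open ℚᵘ.≃-Reasoning

-- Criteria for a rational number to be an integer

IsInteger : ℚ → Set
IsInteger q = ∃ λ z → q ≡ ℤ→ℚ z

+-isInteger : ∀ {p q} → IsInteger p → IsInteger q → IsInteger (p ℚ.+ q)
+-isInteger (i , refl) (j , refl) = i ℤ.+ j , sym (ℤ→ℚ-+ i j)

*-isInteger : ∀ {p q} → IsInteger p → IsInteger q → IsInteger (p ℚ.* q)
*-isInteger (i , refl) (j , refl) = i ℤ.* j , sym (ℤ→ℚ-* i j)

neg-isInteger : ∀ {p} → IsInteger p → IsInteger (ℚ.- p)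
neg-isInteger (i , refl) = ℤ.- i , sym (ℤ→ℚ-neg i)

denominator≡1⇒isInteger : ∀ q → ℚ.↧ₙ q ≡ 1 → IsInteger q
denominator≡1⇒isInteger q@(mkℚ r _ _) refl = r , sym (ℚ.↥p/↧p≡p q)

coprime-↧-↥ : ∀ q → Coprime (ℚ.↧ₙ q) ∣ ℚ.↥ q ∣
coprime-↧-↥ (mkℚ r s-1 c) = Coprime.sym (Coprime.recompute c)

-- A nonzero integer sequence with ratio r / s in lowest terms: s divides every
-- term, and dividing all of them by s gives another such sequence.
integral-geometric⇒s≡1 :
  ∀ r s (z : ℕ → ℕ) → Coprime s r → .{{ℕ.NonZero s}} → .{{ℕ.NonZero (z 0)}} →
  (∀ k → z (suc k) ℕ.* s ≡ r ℕ.* z k) → s ≡ 1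
integral-geometric⇒s≡1 r s z cop step = go z (<-wellFounded _) step
  where
  go : ∀ z → Acc ℕ._<_ (z 0) → .{{ℕ.NonZero (z 0)}} →
       (∀ k → z (suc k) ℕ.* s ≡ r ℕ.* z k) → s ≡ 1
  go z (acc rec) step with s ℕ.≟ 1
  ... | yes s≡1 = s≡1
  ... | no  s≢1 = go w (rec w₀<z₀) {{w₀≢0}} step′
    where
    s∣z : ∀ k → s ∣ z k
    s∣z k = coprime-divisor cop (divides (z (suc k)) (sym (step k)))
    w : ℕ → ℕ
    w k = _∣_.quotient (s∣z k)
    z≡ws : ∀ k → z k ≡ w k ℕ.* s
    z≡ws k = _∣_.equality (s∣z k)
    w₀≢0 : ℕ.NonZero (w 0)
    w₀≢0 = ℕ.m*n≢0⇒m≢0 (w 0)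
      {{subst ℕ.NonZero (z≡ws 0) (ℕ.≢-nonZero (ℕ.≢-nonZero⁻¹ (z 0)))}}
    w₀<z₀ : w 0 ℕ.< z 0
    w₀<z₀ = subst (w 0 ℕ.<_) (sym (z≡ws 0))
      (ℕ.m<m*n (w 0) s {{w₀≢0}} (ℕ.≤∧≢⇒< (ℕ.>-nonZero⁻¹ s) (λ 1≡s → s≢1 (sym 1≡s))))
    step′ : ∀ k → w (suc k) ℕ.* s ≡ r ℕ.* w k
    step′ k = ℕ.*-cancelʳ-≡ _ _ s (begin
      w (suc k) ℕ.* s ℕ.* s   ≡⟨ cong (ℕ._* s) (z≡ws (suc k)) ⟨
      z (suc k) ℕ.* s         ≡⟨ step k ⟩
      r ℕ.* z k               ≡⟨ cong (r ℕ.*_) (z≡ws k) ⟩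
      r ℕ.* (w k ℕ.* s)       ≡⟨ ℕ.*-assoc r (w k) s ⟨
      r ℕ.* w k ℕ.* s         ∎)
      where open ≡-Reasoning

-- A rational whose powers have a common denominator is an integer. It is applied to the norm of an
-- element γ, with the integers D² N(γᵏ) as `z`.
integral-geometric⇒isInteger :
  ∀ q (z : ℕ → ℤ) → z 0 ≢ + 0 →
  (∀ k → ℤ→ℚ (z (suc k)) ≡ q ℚ.* ℤ→ℚ (z k)) → IsInteger q
integral-geometric⇒isInteger q z z₀≢0 step = denominator≡1⇒isInteger q
  (integral-geometric⇒s≡1 (∣ ℚ.↥ q ∣) (ℚ.↧ₙ q) (λ k → ∣ z k ∣) (coprime-↧-↥ q)
    {{_}} {{ℕ.≢-nonZero (λ eq → z₀≢0 (ℤ.∣i∣≡0⇒i≡0 eq))}} step′)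
  where
  open +-*-Solver using (solve; _:=_; _:*_)
  open ≡-Reasoning
  s = ℚ.↧ q
  r = ℚ.↥ q
  stepℤ : ∀ k → z (suc k) ℤ.* s ≡ r ℤ.* z k
  stepℤ k = ℤ→ℚ-injective (begin
    ℤ→ℚ (z (suc k) ℤ.* s)           ≡⟨ ℤ→ℚ-* (z (suc k)) s ⟩
    ℤ→ℚ (z (suc k)) ℚ.* ℤ→ℚ s       ≡⟨ cong (ℚ._* ℤ→ℚ s) (step k) ⟩
    q ℚ.* ℤ→ℚ (z k) ℚ.* ℤ→ℚ s
      ≡⟨ solve 3 (λ a b c → a :* b :* c := a :* c :* b) refl q (ℤ→ℚ (z k)) (ℤ→ℚ s) ⟩
    q ℚ.* ℤ→ℚ s ℚ.* ℤ→ℚ (z k)       ≡⟨ cong (ℚ._* ℤ→ℚ (z k)) (clear-denominator q) ⟩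
    ℤ→ℚ r ℚ.* ℤ→ℚ (z k)             ≡⟨ ℤ→ℚ-* r (z k) ⟨
    ℤ→ℚ (r ℤ.* z k)                 ∎)
  step′ : ∀ k → ∣ z (suc k) ∣ ℕ.* ℚ.↧ₙ q ≡ ∣ r ∣ ℕ.* ∣ z k ∣
  step′ k = trans (sym (ℤ.abs-* (z (suc k)) s))
    (trans (cong ∣_∣ (stepℤ k)) (ℤ.abs-* r (z k)))

-- Coprimality is used twice. First s ∣ d r² gives d = e s. Cancelling one s leaves n s = e r², so s
-- ∣ e and s² ∣ d. This is where square-freeness is finally applied.
squareFree-descent : ∀ d r s n → SquareFree d → .{{ℕ.NonZero s}} → Coprime s r →
  n ℕ.* (s ℕ.* s) ≡ d ℕ.* (r ℕ.* r) → s ≡ 1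
squareFree-descent d r s n sf cop eq = sf s (s²∣d s∣d)
  where
  open ≡-Reasoning
  open ℕ-Solver using (solve; _:=_; _:*_)
  s∣d : s ∣ d
  s∣d = coprime-divisor cop (coprime-divisor cop (divides (n ℕ.* s) (begin
    r ℕ.* (r ℕ.* d)   ≡⟨ solve 2 (λ r d → r :* (r :* d) := d :* (r :* r)) refl r d ⟩
    d ℕ.* (r ℕ.* r)   ≡⟨ eq ⟨
    n ℕ.* (s ℕ.* s)   ≡⟨ ℕ.*-assoc n s s ⟨
    n ℕ.* s ℕ.* s     ∎)))
  s²∣d : s ∣ d → s ℕ.* s ∣ d
  s²∣d (divides e refl) = ℕ.*-monoˡ-∣ s
    (coprime-divisor cop (coprime-divisor cop (divides n (ℕ.*-cancelʳ-≡ _ _ s (begin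
      r ℕ.* (r ℕ.* e) ℕ.* s   ≡⟨ solve 3 (λ r e s → r :* (r :* e) :* s := e :* s :* (r :* r)) refl r e s ⟩
      e ℕ.* s ℕ.* (r ℕ.* r)   ≡⟨ eq ⟨
      n ℕ.* (s ℕ.* s)         ≡⟨ ℕ.*-assoc n s s ⟨
      n ℕ.* s ℕ.* s           ∎)))))

squareFree*square⇒isInteger : ∀ d q → SquareFree d →
  IsInteger (ℤ→ℚ (+ d) ℚ.* (q ℚ.* q)) → IsInteger q
squareFree*square⇒isInteger d q sf (z , dq²≡z) = denominator≡1⇒isInteger q
  (squareFree-descent d (∣ r ∣) (ℚ.↧ₙ q) (∣ z ∣) sf (coprime-↧-↥ q) eqℕ)
  where
  open +-*-Solver using (solve; _:=_; _:*_)
  open ≡-Reasoning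
  s = ℚ.↧ q
  r = ℚ.↥ q
  eqℤ : z ℤ.* (s ℤ.* s) ≡ + d ℤ.* (r ℤ.* r)
  eqℤ = ℤ→ℚ-injective (begin
    ℤ→ℚ (z ℤ.* (s ℤ.* s))
      ≡⟨ trans (ℤ→ℚ-* z (s ℤ.* s)) (cong₂ ℚ._*_ (sym dq²≡z) (ℤ→ℚ-* s s)) ⟩
    ℤ→ℚ (+ d) ℚ.* (q ℚ.* q) ℚ.* (ℤ→ℚ s ℚ.* ℤ→ℚ s)
      ≡⟨ solve 3 (λ d q s → d :* (q :* q) :* (s :* s) := d :* ((q :* s) :* (q :* s))) refl (ℤ→ℚ (+ d)) q (ℤ→ℚ s) ⟩
    ℤ→ℚ (+ d) ℚ.* ((q ℚ.* ℤ→ℚ s) ℚ.* (q ℚ.* ℤ→ℚ s))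
      ≡⟨ cong (λ t → ℤ→ℚ (+ d) ℚ.* (t ℚ.* t)) (clear-denominator q) ⟩
    ℤ→ℚ (+ d) ℚ.* (ℤ→ℚ r ℚ.* ℤ→ℚ r)
      ≡⟨ trans (ℤ→ℚ-* (+ d) (r ℤ.* r)) (cong (ℤ→ℚ (+ d) ℚ.*_) (ℤ→ℚ-* r r)) ⟨
    ℤ→ℚ (+ d ℤ.* (r ℤ.* r))                     ∎)
  eqℕ : ∣ z ∣ ℕ.* (ℚ.↧ₙ q ℕ.* ℚ.↧ₙ q) ≡ d ℕ.* (∣ r ∣ ℕ.* ∣ r ∣)
  eqℕ = begin
    ∣ z ∣ ℕ.* (ℚ.↧ₙ q ℕ.* ℚ.↧ₙ q)   ≡⟨ ℤ.abs-* z (s ℤ.* s) ⟨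
    ∣ z ℤ.* (s ℤ.* s) ∣             ≡⟨ cong ∣_∣ eqℤ ⟩
    ∣ + d ℤ.* (r ℤ.* r) ∣           ≡⟨ trans (ℤ.abs-* (+ d) (r ℤ.* r)) (cong (d ℕ.*_) (ℤ.abs-* r r)) ⟩
    d ℕ.* (∣ r ∣ ℕ.* ∣ r ∣)         ∎

-- Norm and trace of integral elements of ℚ(√d)

module IntegralElements (d : ℕ) where
  open QuadraticField d
  open +-*-Solver using (solve; con; _:=_; _:+_; _:*_; :-_; _:-_)

  norm : K → ℚ
  norm (a +√ b) = a ℚ.* a ℚ.- δ ℚ.* (b ℚ.* b)

  norm-* : ∀ α β → norm (α * β) ≡ norm α ℚ.* norm β
  norm-* (a +√ b) (a′ +√ b′) = solve 5 (λ a b a′ b′ δ →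
    let x = a :* a′ :+ δ :* (b :* b′); y = a :* b′ :+ b :* a′ in
    x :* x :- δ :* (y :* y)
    := (a :* a :- δ :* (b :* b)) :* (a′ :* a′ :- δ :* (b′ :* b′))) refl a b a′ b′ δ

  -- The ℤ-module spanned by the Horner values of the monic polynomial cs at α.
  -- Its generators h satisfy h = c + α h′ with h′ the next one, so
  -- multiplication by α preserves it once the value of cs itself vanishes.
  HornerSpan : K → List ℤ → K → Set
  HornerSpan α []       β = ∃ λ z → β ≡ ℤ→K z
  HornerSpan α (c ∷ cs) β =
    ∃₂ λ z β′ → HornerSpan α cs β′ × β ≡ ℤ→K z * evalMonic (c ∷ cs) α + β′

  HornerSpan-ℤ : ∀ α cs k → HornerSpan α cs (ℤ→K k)
  HornerSpan-ℤ α []       k = k , refl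
  HornerSpan-ℤ α (c ∷ cs) k = + 0 , ℤ→K k , HornerSpan-ℤ α cs k , eq (evalMonic (c ∷ cs) α)
    where
    eq : ∀ h → ℤ→K k ≡ 0K * h + ℤ→K k
    eq (x +√ y) = cong₂ _+√_
      (solve 4 (λ x y k δ → k := con 0ℚ :* x :+ δ :* (con 0ℚ :* y) :+ k) refl x y (ℤ→ℚ k) δ)
      (solve 2 (λ x y → con 0ℚ := con 0ℚ :* y :+ con 0ℚ :* x :+ con 0ℚ) refl x y)

  HornerSpan-+ : ∀ α cs {β γ} → HornerSpan α cs β → HornerSpan α cs γ → HornerSpan α cs (β + γ)
  HornerSpan-+ α []       (z , refl) (w , refl) =
    z ℤ.+ w , cong₂ _+√_ (sym (ℤ→ℚ-+ z w)) (ℚ.+-identityˡ 0ℚ)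
  HornerSpan-+ α (c ∷ cs) (z , β , β∈ , refl) (w , γ , γ∈ , refl) =
    z ℤ.+ w , β + γ , HornerSpan-+ α cs β∈ γ∈ , eq (evalMonic (c ∷ cs) α) β γ
    where
    eq : ∀ h β γ → ℤ→K z * h + β + (ℤ→K w * h + γ) ≡ ℤ→K (z ℤ.+ w) * h + (β + γ)
    eq (x +√ y) (a +√ b) (a′ +√ b′) rewrite ℤ→ℚ-+ z w = cong₂ _+√_
      (solve 7 (λ x y a a′ z w δ →
        z :* x :+ δ :* (con 0ℚ :* y) :+ a :+ (w :* x :+ δ :* (con 0ℚ :* y) :+ a′)
        := (z :+ w) :* x :+ δ :* (con 0ℚ :* y) :+ (a :+ a′)) refl x y a a′ (ℤ→ℚ z) (ℤ→ℚ w) δ)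
      (solve 6 (λ x y b b′ z w →
        z :* y :+ con 0ℚ :* x :+ b :+ (w :* y :+ con 0ℚ :* x :+ b′)
        := (z :+ w) :* y :+ con 0ℚ :* x :+ (b :+ b′)) refl x y b b′ (ℤ→ℚ z) (ℤ→ℚ w))

  -- Rests on α h = (c + α h) - c: the generator h becomes the next Horner value, and the correction
  -- -z c is an integer, which every Horner span contains.
  horner-step : ∀ α h β z c →
    α * (ℤ→K z * h + β) ≡ ℤ→K z * (ℤ→K c + α * h) + (α * β + ℤ→K (ℤ.- (z ℤ.* c)))
  horner-step (p +√ q) (x +√ y) (a +√ b) z c
    rewrite ℤ→ℚ-neg (z ℤ.* c) | ℤ→ℚ-* z c = cong₂ _+√_
    (solve 9 (λ p q x y a b z c δ →
      let o = con 0ℚ in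
      p :* (z :* x :+ δ :* (o :* y) :+ a) :+ δ :* (q :* (z :* y :+ o :* x :+ b))
      := z :* (c :+ (p :* x :+ δ :* (q :* y))) :+ δ :* (o :* (o :+ (p :* y :+ q :* x)))
         :+ (p :* a :+ δ :* (q :* b) :+ (:- (z :* c))))
      refl p q x y a b (ℤ→ℚ z) (ℤ→ℚ c) δ)
    (solve 9 (λ p q x y a b z c δ →
      let o = con 0ℚ in
      p :* (z :* y :+ o :* x :+ b) :+ q :* (z :* x :+ δ :* (o :* y) :+ a)
      := z :* (o :+ (p :* y :+ q :* x)) :+ o :* (c :+ (p :* x :+ δ :* (q :* y)))
         :+ (p :* b :+ q :* a :+ o))
      refl p q x y a b (ℤ→ℚ z) (ℤ→ℚ c) δ)

  ℤ→K-as-sum : ∀ z → ℤ→K z ≡ ℤ→K z * 1K + 0K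
  ℤ→K-as-sum z = cong₂ _+√_
    (solve 2 (λ z δ → z := z :* con 1ℚ :+ δ :* (con 0ℚ :* con 0ℚ) :+ con 0ℚ) refl (ℤ→ℚ z) δ)
    (solve 1 (λ z → con 0ℚ := z :* con 0ℚ :+ con 0ℚ :* con 1ℚ :+ con 0ℚ) refl (ℤ→ℚ z))

  +-identityˡ : ∀ α → 0K + α ≡ α
  +-identityˡ (a +√ b) = cong₂ _+√_ (ℚ.+-identityˡ a) (ℚ.+-identityˡ b)

  HornerSpan-* : ∀ α c cs {β} → HornerSpan α cs β → HornerSpan α (c ∷ cs) (α * β)
  HornerSpan-* α c [] (z , refl) =
    z , ℤ→K (ℤ.- (z ℤ.* c)) , (ℤ.- (z ℤ.* c) , refl) , (begin
      -- The innermost Horner value is 1, with nothing after it, so `horner-step` is used with h = 1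
      -- and β = 0.
      α * ℤ→K z                    ≡⟨ cong (α *_) (ℤ→K-as-sum z) ⟩
      α * (ℤ→K z * 1K + 0K)        ≡⟨ horner-step α 1K 0K z c ⟩
      ℤ→K z * (ℤ→K c + α * 1K) + (α * 0K + ℤ→K (ℤ.- (z ℤ.* c)))
        ≡⟨ cong (λ t → ℤ→K z * (ℤ→K c + α * 1K) + t) (trans (cong (_+ ℤ→K (ℤ.- (z ℤ.* c))) (*-zeroʳ α)) (+-identityˡ _)) ⟩
      ℤ→K z * (ℤ→K c + α * 1K) + ℤ→K (ℤ.- (z ℤ.* c)) ∎)
    where open ≡-Reasoning
  HornerSpan-* α c (c′ ∷ cs) (z , β′ , β′∈ , refl) =
    z , α * β′ + ℤ→K (ℤ.- (z ℤ.* c)) ,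
    HornerSpan-+ α (c′ ∷ cs) (HornerSpan-* α c′ cs β′∈) (HornerSpan-ℤ α (c′ ∷ cs) (ℤ.- (z ℤ.* c))) ,
    horner-step α (evalMonic (c′ ∷ cs) α) β′ z c

  -- The outermost generator vanishes at a root. This brings the product α β, which `HornerSpan-*`
  -- places one span higher, back to where β was.
  HornerSpan-tail : ∀ α c cs → evalMonic (c ∷ cs) α ≡ 0K →
                    ∀ {β} → HornerSpan α (c ∷ cs) β → HornerSpan α cs β
  HornerSpan-tail α c cs root (z , β′ , β′∈ , refl) = subst (HornerSpan α cs) (sym eq) β′∈
    where
    eq : ℤ→K z * evalMonic (c ∷ cs) α + β′ ≡ β′
    eq = trans (cong (λ h → ℤ→K z * h + β′) root)
           (trans (cong (_+ β′) (*-zeroʳ (ℤ→K z))) (+-identityˡ β′))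

  infix 4 _Clears_
  _Clears_ : ℤ → K → Set
  D Clears (a +√ b) = IsInteger (ℤ→ℚ D ℚ.* a) × IsInteger (ℤ→ℚ D ℚ.* b)

  clears-* : ∀ D E β → D Clears β → (E ℤ.* D) Clears β
  clears-* D E (a +√ b) (Da , Db) = lift a Da , lift b Db
    where
    lift : ∀ q → IsInteger (ℤ→ℚ D ℚ.* q) → IsInteger (ℤ→ℚ (E ℤ.* D) ℚ.* q)
    lift q Dq = subst IsInteger
      (trans (sym (ℚ.*-assoc (ℤ→ℚ E) (ℤ→ℚ D) q)) (cong (ℚ._* q) (sym (ℤ→ℚ-* E D))))
      (*-isInteger (E , refl) Dq)

  clears-combination : ∀ D z h β → D Clears h → D Clears β → D Clears (ℤ→K z * h + β)
  clears-combination D z (x +√ y) (a +√ b) (Dx , Dy) (Da , Db) =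
    subst IsInteger
      (solve 6 (λ D z x y a δ → z :* (D :* x) :+ D :* a
                             := D :* (z :* x :+ δ :* (con 0ℚ :* y) :+ a)) refl (ℤ→ℚ D) (ℤ→ℚ z) x y a δ)
      (+-isInteger (*-isInteger (z , refl) Dx) Da) ,
    subst IsInteger
      (solve 5 (λ D z x y b → z :* (D :* y) :+ D :* b
                             := D :* (z :* y :+ con 0ℚ :* x :+ b)) refl (ℤ→ℚ D) (ℤ→ℚ z) x y b)
      (+-isInteger (*-isInteger (z , refl) Dy) Db)

  denominator : K → ℤ
  denominator (a +√ b) = ℚ.↧ a ℤ.* ℚ.↧ b

  denominator≢0 : ∀ β → denominator β ≢ + 0
  denominator≢0 (a@record{} +√ b@record{}) ()

  denominator-clears : ∀ β → denominator β Clears β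
  denominator-clears (a +√ b) =
    (ℚ.↥ a ℤ.* ℚ.↧ b , trans (cong (ℚ._* a) (ℤ→ℚ-* (ℚ.↧ a) (ℚ.↧ b)))
      (trans (solve 3 (λ a s t → s :* t :* a := a :* s :* t) refl a (ℤ→ℚ (ℚ.↧ a)) (ℤ→ℚ (ℚ.↧ b)))
        (trans (cong (ℚ._* ℤ→ℚ (ℚ.↧ b)) (clear-denominator a)) (sym (ℤ→ℚ-* (ℚ.↥ a) (ℚ.↧ b)))))) ,
    (ℚ.↧ a ℤ.* ℚ.↥ b , trans (cong (ℚ._* b) (ℤ→ℚ-* (ℚ.↧ a) (ℚ.↧ b)))
      (trans (solve 3 (λ b s t → s :* t :* b := s :* (b :* t)) refl b (ℤ→ℚ (ℚ.↧ a)) (ℤ→ℚ (ℚ.↧ b)))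
        (trans (cong (ℤ→ℚ (ℚ.↧ a) ℚ.*_) (clear-denominator b)) (sym (ℤ→ℚ-* (ℚ.↧ a) (ℚ.↥ b))))))

  -- The span has finitely many generators, so the product of their denominators serves for all of
  -- its elements.
  HornerSpan-denominator : ∀ α cs →
    ∃ λ D → D ≢ + 0 × (∀ {β} → HornerSpan α cs β → D Clears β)
  HornerSpan-denominator α [] = + 1 , (λ ()) ,
    λ { (z , refl) → (z , ℚ.*-identityˡ (ℤ→ℚ z)) , (+ 0 , refl) }
  HornerSpan-denominator α (c ∷ cs) with HornerSpan-denominator α cs
  ... | D , D≢0 , D-clears = E ℤ.* D , ED≢0 ,
    λ { (z , β′ , β′∈ , refl) → clears-combination (E ℤ.* D) z h β′
          (subst (_Clears h) (ℤ.*-comm D E) (clears-* E D h (denominator-clears h)))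
          (clears-* D E β′ (D-clears β′∈)) }
    where
    h = evalMonic (c ∷ cs) α
    E = denominator h
    ED≢0 : E ℤ.* D ≢ + 0
    ED≢0 eq = [ denominator≢0 h , D≢0 ]′ (ℤ.i*j≡0⇒i≡0∨j≡0 E eq)

  infixr 8 _^_
  _^_ : K → ℕ → K
  γ ^ zero  = 1K
  γ ^ suc k = γ * γ ^ k

  -- If D clears both coordinates of γᵏ, then D² N(γᵏ) is an integer. By multiplicativity these
  -- integers form a geometric sequence of ratio N(γ), starting at D² ≠ 0.
  powers-cleared⇒norm-isInteger : ∀ D → D ≢ + 0 → ∀ γ →
    (∀ k → D Clears γ ^ k) → IsInteger (norm γ)
  powers-cleared⇒norm-isInteger D D≢0 γ clears =
    integral-geometric⇒isInteger (norm γ) z z₀≢0 step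
    where
    open ≡-Reasoning
    scaled-norm : ∀ β → D Clears β → IsInteger (ℤ→ℚ D ℚ.* ℤ→ℚ D ℚ.* norm β)
    scaled-norm (a +√ b) (Da , Db) = subst IsInteger
      (solve 4 (λ D a b δ → (D :* a) :* (D :* a) :+ (:- (δ :* ((D :* b) :* (D :* b))))
          := D :* D :* (a :* a :- δ :* (b :* b))) refl (ℤ→ℚ D) a b δ)
      (+-isInteger (*-isInteger Da Da) (neg-isInteger (*-isInteger (+ d , refl) (*-isInteger Db Db))))
    z : ℕ → ℤ
    z k = proj₁ (scaled-norm (γ ^ k) (clears k))
    z-eq : ∀ k → ℤ→ℚ D ℚ.* ℤ→ℚ D ℚ.* norm (γ ^ k) ≡ ℤ→ℚ (z k)
    z-eq k = proj₂ (scaled-norm (γ ^ k) (clears k))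
    z₀≡D² : z 0 ≡ D ℤ.* D
    z₀≡D² = ℤ→ℚ-injective (begin
      ℤ→ℚ (z 0)                          ≡⟨ z-eq 0 ⟨
      ℤ→ℚ D ℚ.* ℤ→ℚ D ℚ.* norm 1K
        ≡⟨ solve 2 (λ D δ → D :* D :* (con 1ℚ :* con 1ℚ :- δ :* (con 0ℚ :* con 0ℚ)) := D :* D) refl (ℤ→ℚ D) δ ⟩
      ℤ→ℚ D ℚ.* ℤ→ℚ D                    ≡⟨ ℤ→ℚ-* D D ⟨
      ℤ→ℚ (D ℤ.* D)                      ∎)
    z₀≢0 : z 0 ≢ + 0
    z₀≢0 eq = [ D≢0 , D≢0 ]′ (ℤ.i*j≡0⇒i≡0∨j≡0 D (trans (sym z₀≡D²) eq))
    step : ∀ k → ℤ→ℚ (z (suc k)) ≡ norm γ ℚ.* ℤ→ℚ (z k)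
    step k = begin
      ℤ→ℚ (z (suc k))                                     ≡⟨ z-eq (suc k) ⟨
      ℤ→ℚ D ℚ.* ℤ→ℚ D ℚ.* norm (γ * γ ^ k)                ≡⟨ cong (ℤ→ℚ D ℚ.* ℤ→ℚ D ℚ.*_) (norm-* γ (γ ^ k)) ⟩
      ℤ→ℚ D ℚ.* ℤ→ℚ D ℚ.* (norm γ ℚ.* norm (γ ^ k))
        ≡⟨ solve 3 (λ D n p → D :* D :* (n :* p) := n :* (D :* D :* p)) refl (ℤ→ℚ D) (norm γ) (norm (γ ^ k)) ⟩
      norm γ ℚ.* (ℤ→ℚ D ℚ.* ℤ→ℚ D ℚ.* norm (γ ^ k))       ≡⟨ cong (norm γ ℚ.*_) (z-eq k) ⟩
      norm γ ℚ.* ℤ→ℚ (z k)                                ∎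

  +1-distribʳ : ∀ α β → (α + 1K) * β ≡ α * β + β
  +1-distribʳ (a +√ b) (x +√ y) = cong₂ _+√_
    (solve 5 (λ a b x y δ → (a :+ con 1ℚ) :* x :+ δ :* ((b :+ con 0ℚ) :* y)
                         := a :* x :+ δ :* (b :* y) :+ x) refl a b x y δ)
    (solve 4 (λ a b x y → (a :+ con 1ℚ) :* y :+ (b :+ con 0ℚ) :* x
                         := a :* y :+ b :* x :+ y) refl a b x y)

  -- The module stable under α is also stable under α + 1, since (α + 1) β = α β + β. One module
  -- therefore handles both norms, and α + 1 is never shown to satisfy a monic polynomial. The
  -- second norm is what yields the trace.
  integral⇒norms-areIntegers : ∀ α → Integral α →
    IsInteger (norm α) × IsInteger (norm (α + 1K))
  -- The empty list stands for the constant polynomial 1, which has no root.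
  integral⇒norms-areIntegers α ([] , ())
  integral⇒norms-areIntegers α (c ∷ cs , root) with HornerSpan-denominator α cs
  ... | D , D≢0 , D-clears = stable⇒ α α-stable ,
    stable⇒ (α + 1K) (λ {β} β∈ → subst M (sym (+1-distribʳ α β)) (HornerSpan-+ α cs (α-stable β∈) β∈))
    where
    M : K → Set
    M = HornerSpan α cs
    α-stable : ∀ {β} → M β → M (α * β)
    α-stable β∈ = HornerSpan-tail α c cs root (HornerSpan-* α c cs β∈)
    stable⇒ : ∀ γ → (∀ {β} → M β → M (γ * β)) → IsInteger (norm γ)
    stable⇒ γ stable = powers-cleared⇒norm-isInteger D D≢0 γ (λ k → D-clears (power∈ k))
      where
      power∈ : ∀ k → M (γ ^ k)
      power∈ zero    = HornerSpan-ℤ α cs (+ 1)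
      power∈ (suc k) = stable (power∈ k)

  integral⇒half-integers : SquareFree d → ∀ {a b} → Integral (a +√ b) →
    ∃₂ λ u v → ∃ λ n → a ℚ.+ a ≡ ℤ→ℚ u × b ℚ.+ b ≡ ℤ→ℚ v × u ℤ.* u ≡ + d ℤ.* (v ℤ.* v) ℤ.+ + 4 ℤ.* n
  integral⇒half-integers sf {a} {b} int
    with integral⇒norms-areIntegers (a +√ b) int
  ... | (n , Nα≡n) , N[α+1] = u , v , n , 2a≡u , 2b≡v , ℤ→ℚ-injective (begin
      ℤ→ℚ (u ℤ.* u)                              ≡⟨ ℤ→ℚ-* u u ⟩
      ℤ→ℚ u ℚ.* ℤ→ℚ u                            ≡⟨ cong (λ t → t ℚ.* t) 2a≡u ⟨
      (a ℚ.+ a) ℚ.* (a ℚ.+ a)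
        ≡⟨ solve 3 (λ a b δ → (a :+ a) :* (a :+ a)
             := δ :* ((b :+ b) :* (b :+ b)) :+ con (ℤ→ℚ (+ 4)) :* (a :* a :- δ :* (b :* b))) refl a b δ ⟩
      δ ℚ.* ((b ℚ.+ b) ℚ.* (b ℚ.+ b)) ℚ.+ ℤ→ℚ (+ 4) ℚ.* norm (a +√ b)
        ≡⟨ cong₂ (λ s t → δ ℚ.* (s ℚ.* s) ℚ.+ ℤ→ℚ (+ 4) ℚ.* t) 2b≡v Nα≡n ⟩
      δ ℚ.* (ℤ→ℚ v ℚ.* ℤ→ℚ v) ℚ.+ ℤ→ℚ (+ 4) ℚ.* ℤ→ℚ n
        ≡⟨ cong₂ ℚ._+_ (trans (ℤ→ℚ-* (+ d) (v ℤ.* v)) (cong (δ ℚ.*_) (ℤ→ℚ-* v v))) (ℤ→ℚ-* (+ 4) n) ⟨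
      ℤ→ℚ (+ d ℤ.* (v ℤ.* v)) ℚ.+ ℤ→ℚ (+ 4 ℤ.* n)  ≡⟨ ℤ→ℚ-+ (+ d ℤ.* (v ℤ.* v)) (+ 4 ℤ.* n) ⟨
      ℤ→ℚ (+ d ℤ.* (v ℤ.* v) ℤ.+ + 4 ℤ.* n)      ∎)
    where
    open ≡-Reasoning
    -- 2a = N(α + 1) - (N(α) + 1).
    trace : IsInteger (a ℚ.+ a)
    trace = subst IsInteger
      (solve 3 (λ a b δ → ((a :+ con 1ℚ) :* (a :+ con 1ℚ) :- δ :* ((b :+ con 0ℚ) :* (b :+ con 0ℚ)))
                            :+ (:- ((a :* a :- δ :* (b :* b)) :+ con 1ℚ)) := a :+ a) refl a b δ)
      (+-isInteger N[α+1] (neg-isInteger (+-isInteger (n , Nα≡n) (+ 1 , refl))))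
    u = proj₁ trace
    2a≡u = proj₂ trace
    -- d (2b)² = (2a)² - 4 N(α) is an integer, and d is square-free.
    irrational : IsInteger (b ℚ.+ b)
    irrational = squareFree*square⇒isInteger d (b ℚ.+ b) sf (subst IsInteger
      (solve 3 (λ a b δ → (a :+ a) :* (a :+ a) :+ (:- (con (ℤ→ℚ (+ 4)) :* (a :* a :- δ :* (b :* b))))
                 := δ :* ((b :+ b) :* (b :+ b))) refl a b δ)
      (+-isInteger (*-isInteger trace trace)
        (neg-isInteger (*-isInteger (+ 4 , refl) (n , Nα≡n)))))
    v = proj₁ irrational
    2b≡v = proj₂ irrational

-- Small values of the norm form of ℤ[ε]

IsSquare : ℕ → Set
IsSquare n = ∃ λ r → n ≡ r ℕ.* r

prime⇒¬square : ∀ {p} → Prime p → ¬ IsSquare p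
prime⇒¬square p-prime (r , refl) with prime⇒irreducible p-prime (divides r refl)
... | inj₁ refl  = ¬prime[1] p-prime
... | inj₂ r≡r*r = ¬prime[1] (subst Prime (trans (sym r≡r*r) r≡1) p-prime)
  where
  instance
    r≢0 : ℕ.NonZero r
    r≢0 = ℕ.m*n≢0⇒m≢0 r {{prime⇒nonZero p-prime}}
  r≡1 : r ≡ 1
  r≡1 = sym (ℕ.*-cancelʳ-≡ 1 r r (trans (ℕ.*-identityˡ r) r≡r*r))

-- If a, t and b are all positive, then (a - 1)(t - 1) ≥ 0 gives a t ≥ a + t - 1, so n ≥ 1 + (a + t
-- - 1) = m b ≥ m. Hence n < m forces a t = 0: a vanishing b makes a and t vanish too.
product-bound : ∀ {m n} a t b → m ℕ.* b ≡ a ℕ.+ t → n ≡ b ℕ.* b ℕ.+ a ℕ.* t →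
                n ℕ.< m → IsSquare n
product-bound zero    t b _ n≡ _ = b , trans n≡ (ℕ.+-identityʳ _)
product-bound (suc a) zero b _ n≡ _ =
  b , trans n≡ (trans (cong (b ℕ.* b ℕ.+_) (ℕ.*-zeroʳ a)) (ℕ.+-identityʳ _))
product-bound {m} (suc a) (suc t) zero mb≡a+t _ _ =
  contradiction (trans (sym (ℕ.*-zeroʳ m)) mb≡a+t) λ ()
product-bound {m} {n} (suc a) (suc t) b@(suc _) mb≡a+t n≡ n<m =
  contradiction n<m (ℕ.≤⇒≯ (begin
    m                                       ≤⟨ ℕ.m≤m*n m b ⟩
    m ℕ.* b                                 ≡⟨ mb≡a+t ⟩
    suc a ℕ.+ suc t                         ≡⟨ cong suc (ℕ.+-comm a (suc t)) ⟩
    1 ℕ.+ (suc t ℕ.+ a)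
      ≤⟨ ℕ.+-mono-≤ {1} {b ℕ.* b} (s≤s z≤n) (ℕ.+-monoʳ-≤ (suc t) (ℕ.m≤m*n a (suc t))) ⟩
    b ℕ.* b ℕ.+ suc a ℕ.* suc t             ≡⟨ n≡ ⟨
    n                                       ∎))
  where open ℕ.≤-Reasoning

module NormForm (m : ℕ) where
  open ℤ-Solver using (solve; con; _:=_; _:+_; _:*_; :-_; _:-_)

  -- The norm of x + yε.
  Q : ℤ → ℤ → ℤ
  Q x y = x ℤ.* x ℤ.+ + m ℤ.* x ℤ.* y ℤ.- y ℤ.* y

  -- (y − mx) + xε = ε⁻¹(x + yε), and ε⁻¹ has norm −1.
  Q-unit : ∀ x w → Q x (+ m ℤ.* x ℤ.+ w) ≡ ℤ.- Q w x
  Q-unit x w = solve 3 (λ m x w →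
    let y = m :* x :+ w in
    x :* x :+ m :* x :* y :- y :* y
    := :- (w :* w :+ m :* w :* x :- x :* x)) refl (+ m) x w

  -- The conjugate of ε is m - ε, so -(m y + c) + y ε is minus the conjugate of c + y ε.
  Q-conjugate : ∀ c y → Q (ℤ.- (+ m ℤ.* y ℤ.+ c)) y ≡ Q c y
  Q-conjugate c y = solve 3 (λ m c y →
    let x = :- (m :* y :+ c) in
    x :* x :+ m :* x :* y :- y :* y
    := c :* c :+ m :* c :* y :- y :* y) refl (+ m) c y

  Q-neg : ∀ x y → Q x (ℤ.- y) ≡ Q (ℤ.- x) y
  Q-neg x y = solve 3 (λ m x y →
    x :* x :+ m :* x :* (:- y) :- (:- y) :* (:- y)
    := (:- x) :* (:- x) :+ m :* (:- x) :* y :- y :* y) refl (+ m) x y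

  pos-mul-add : ∀ b c → + (m ℕ.* b ℕ.+ c) ≡ + m ℤ.* + b ℤ.+ + c
  pos-mul-add b c = trans (ℤ.pos-+ (m ℕ.* b) c) (cong (ℤ._+ + c) (ℤ.pos-* m b))

  pos-squares : ∀ b a t → + (b ℕ.* b ℕ.+ a ℕ.* t) ≡ + b ℤ.* + b ℤ.+ + a ℤ.* + t
  pos-squares b a t = trans (ℤ.pos-+ (b ℕ.* b) (a ℕ.* t)) (cong₂ ℤ._+_ (ℤ.pos-* b b) (ℤ.pos-* a t))

  pos-sum : ∀ a t b → m ℕ.* b ≡ a ℕ.+ t → + m ℤ.* + b ≡ + a ℤ.+ + t
  pos-sum a t b eq = trans (sym (ℤ.pos-* m b)) (trans (cong +_ eq) (ℤ.pos-+ a t))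

  -- In the range 0 ≤ a ≤ m b the norm is a sum of two nonnegative terms, with no cancellation. This
  -- is the shape that `product-bound` needs, and the place where the descent stops.
  Q-balanced : ∀ a t b → m ℕ.* b ≡ a ℕ.+ t → Q (+ b) (+ a) ≡ + (b ℕ.* b ℕ.+ a ℕ.* t)
  Q-balanced a t b eq = begin
    Q (+ b) (+ a)
      ≡⟨ cong (λ s → + b ℤ.* + b ℤ.+ s ℤ.* + a ℤ.- + a ℤ.* + a) (pos-sum a t b eq) ⟩
    + b ℤ.* + b ℤ.+ (+ a ℤ.+ + t) ℤ.* + a ℤ.- + a ℤ.* + a
      ≡⟨ solve 3 (λ a t b → b :* b :+ (a :+ t) :* a :- a :* a := b :* b :+ a :* t) refl (+ a) (+ t) (+ b) ⟩
    + b ℤ.* + b ℤ.+ + a ℤ.* + t                              ≡⟨ pos-squares b a t ⟨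
    + (b ℕ.* b ℕ.+ a ℕ.* t)                                  ∎
    where open ≡-Reasoning

  -- -a + b ε is ε times the conjugate of b + a ε, and ε has norm -1.
  Q-balanced′ : ∀ a t b → m ℕ.* b ≡ a ℕ.+ t → Q (ℤ.- + a) (+ b) ≡ ℤ.- + (b ℕ.* b ℕ.+ a ℕ.* t)
  Q-balanced′ a t b eq = begin
    Q (ℤ.- + a) (+ b)
      ≡⟨ solve 3 (λ m a b → (:- a) :* (:- a) :+ m :* (:- a) :* b :- b :* b
                         := :- (b :* b :+ m :* b :* a :- a :* a)) refl (+ m) (+ a) (+ b) ⟩
    ℤ.- Q (+ b) (+ a)
      ≡⟨ cong ℤ.-_ (Q-balanced a t b eq) ⟩
    ℤ.- + (b ℕ.* b ℕ.+ a ℕ.* t) ∎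
    where open ≡-Reasoning

  -- While y > m x, dividing by ε turns (x, m x + w) into (w, x), with both coordinates still
  -- nonnegative and the norm only changing sign. The descent ends at x = 0, where the norm is -y²,
  -- or in the range of `Q-balanced`.
  small-norm-isSquare-ℕ : ∀ {n} → n ℕ.< m → ∀ x y → ∣ Q (+ x) (+ y) ∣ ≡ n → IsSquare n
  small-norm-isSquare-ℕ {n} n<m x y = go x y (<-wellFounded (x ℕ.+ y))
    where
    go : ∀ x y → Acc ℕ._<_ (x ℕ.+ y) → ∣ Q (+ x) (+ y) ∣ ≡ n → IsSquare n
    go x y (acc rec) |Q|≡n with ℕ.≤-total y (m ℕ.* x)
    ... | inj₁ y≤mx with ℕ.m≤n⇒∃[o]m+o≡n y≤mx
    ...   | t , y+t≡mx =
      product-bound y t x (sym y+t≡mx)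
        (trans (sym |Q|≡n) (cong ∣_∣ (Q-balanced y t x (sym y+t≡mx)))) n<m
    go zero y (acc rec) |Q|≡n | inj₂ _ = y , (begin
      n                            ≡⟨ |Q|≡n ⟨
      ∣ Q (+ 0) (+ y) ∣
        ≡⟨ cong ∣_∣ (solve 2 (λ m y → con (+ 0) :* con (+ 0) :+ m :* con (+ 0) :* y :- y :* y := :- (y :* y)) refl (+ m) (+ y)) ⟩
      ∣ ℤ.- (+ y ℤ.* + y) ∣        ≡⟨ ℤ.∣-i∣≡∣i∣ (+ y ℤ.* + y) ⟩
      ∣ + y ℤ.* + y ∣              ≡⟨ ℤ.abs-* (+ y) (+ y) ⟩
      y ℕ.* y                      ∎)
      where open ≡-Reasoning
    go x@(suc _) y (acc rec) |Q|≡n | inj₂ mx≤y with ℕ.m≤n⇒∃[o]m+o≡n mx≤y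
    ...   | w , refl = go w x (rec smaller) (begin
      ∣ Q (+ w) (+ x) ∣                         ≡⟨ ℤ.∣-i∣≡∣i∣ (Q (+ w) (+ x)) ⟨
      ∣ ℤ.- Q (+ w) (+ x) ∣                     ≡⟨ cong ∣_∣ (Q-unit (+ x) (+ w)) ⟨
      ∣ Q (+ x) (+ m ℤ.* + x ℤ.+ + w) ∣         ≡⟨ cong (λ y → ∣ Q (+ x) y ∣) (pos-mul-add x w) ⟨
      ∣ Q (+ x) (+ (m ℕ.* x ℕ.+ w)) ∣           ≡⟨ |Q|≡n ⟩
      n                                         ∎)
      where
      open ≡-Reasoning
      0<mx : 0 ℕ.< m ℕ.* x
      -- Here m > 0 comes from n < m, and x is a successor; so the sum of the coordinates drops
      -- strictly.
      0<mx = ℕ.*-mono-< (ℕ.≤-<-trans z≤n n<m) (s≤s z≤n)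
      smaller : w ℕ.+ x ℕ.< x ℕ.+ (m ℕ.* x ℕ.+ w)
      smaller = subst (ℕ._< x ℕ.+ (m ℕ.* x ℕ.+ w)) (ℕ.+-comm x w)
        (ℕ.+-monoʳ-< x (ℕ.m<n+m w 0<mx))

  -- An overall sign leaves coordinates of equal sign, which are settled already, or an element -a +
  -- b ε. For a ≤ m b its norm is again free of cancellation; for a = m b + c, conjugation leads to
  -- c + b ε, with nonnegative coordinates.
  small-norm-isSquare : ∀ {n} → n ℕ.< m → ∀ x y → ∣ Q x y ∣ ≡ n → IsSquare n
  small-norm-isSquare {n} n<m = cases
    where
    opposite : ∀ a b → ∣ Q (ℤ.- + a) (+ b) ∣ ≡ n → IsSquare n
    opposite a b |Q|≡n with ℕ.≤-total a (m ℕ.* b)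
    ... | inj₁ a≤mb with ℕ.m≤n⇒∃[o]m+o≡n a≤mb
    ...   | t , a+t≡mb =
      product-bound a t b (sym a+t≡mb)
        (trans (sym |Q|≡n) (trans (cong ∣_∣ (Q-balanced′ a t b (sym a+t≡mb))) (ℤ.∣-i∣≡∣i∣ (+ (b ℕ.* b ℕ.+ a ℕ.* t))))) n<m
    opposite a b |Q|≡n | inj₂ mb≤a with ℕ.m≤n⇒∃[o]m+o≡n mb≤a
    ...   | c , refl = small-norm-isSquare-ℕ n<m c b
      (trans (sym (cong ∣_∣ (trans (cong (λ a → Q (ℤ.- a) (+ b)) (pos-mul-add b c)) (Q-conjugate (+ c) (+ b))))) |Q|≡n)
    cases : ∀ x y → ∣ Q x y ∣ ≡ n → IsSquare n
    cases (+ a)    (+ b)    = small-norm-isSquare-ℕ n<m a b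
    cases -[1+ a ] (+ b)    = opposite (suc a) b
    cases (+ a)    -[1+ b ] = λ eq → opposite a (suc b) (trans (sym (cong ∣_∣ (Q-neg (+ a) (+ suc b)))) eq)
    cases -[1+ a ] -[1+ b ] = λ eq → small-norm-isSquare-ℕ n<m (suc a) (suc b) (trans (sym (cong ∣_∣ (Q-neg -[1+ a ] (+ suc b)))) eq)

-- Divisibility by 2 and by primes

even-square⇒even : ∀ t k → t ℤ.* t ≡ k ℤ.* + 2 → ∃ λ x → t ≡ x ℤ.* + 2
even-square⇒even t k eq = ℤ._∣_.quotient 2∣t , ℤ._∣_.equality 2∣t
  where
  2∣t : + 2 ℤ.∣ t
  2∣t = ℤ.∣ᵤ⇒∣ (reduce (euclidsLemma (∣ t ∣) (∣ t ∣) (from-yes (prime? 2))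
    (divides (∣ k ∣) (trans (sym (ℤ.abs-* t t)) (trans (cong ∣_∣ eq) (ℤ.abs-* k (+ 2)))))))

∃-primeDivisor : ∀ n → .{{ℕ.NonTrivial n}} → ∃ λ p → Prime p × p ∣ n
∃-primeDivisor n with factorise n {{ℕ.nonTrivial⇒nonZero n}}
... | record { factors = [] ; isFactorisation = n≡1 } = contradiction n≡1 ℕ.nonTrivial⇒≢1
... | record { factors = p ∷ ps ; isFactorisation = n≡ ; factorsPrime = p-prime ∷ _ } =
  p , p-prime , subst (p ∣_) (sym n≡) (ℕ.m∣m*n _)

composite⇒properPrimeDivisor : ∀ {n} → Composite n → ∃ λ p → Prime p × p ℕ.< n × p ∣ n
composite⇒properPrimeDivisor (composite {a} a<n a∣n) with ∃-primeDivisor a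
... | p , p-prime , p∣a = p , p-prime ,
  ℕ.≤-<-trans (ℕ.∣⇒≤ {{ℕ.nonTrivial⇒nonZero a}} p∣a) a<n , ℕ.∣-trans p∣a a∣n

open import Data.Nat.Base using (_+_; _^_; _>_)

-- Integral elements in the basis 1, ε

module EpsilonBasis (m : ℕ) where
  open NormForm m

  open QuadraticField (m ^ 2 + 4) renaming (_+_ to _⊹_; _*_ to _✶_)
  open IntegralElements (m ^ 2 + 4) using (integral⇒half-integers; +-identityˡ)

  M : ℚ
  M = ℤ→ℚ (+ m)

  +d≡m²+4 : + (m ^ 2 + 4) ≡ + m ℤ.* + m ℤ.+ + 4
  +d≡m²+4 = trans (ℤ.pos-+ (m ^ 2) 4) (cong (ℤ._+ + 4)
    (trans (cong (λ k → + (m ℕ.* k)) (ℕ.*-identityʳ m)) (ℤ.pos-* m m)))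

  δ≡M²+4 : δ ≡ M ℚ.* M ℚ.+ ℤ→ℚ (+ 4)
  δ≡M²+4 = trans (cong ℤ→ℚ +d≡m²+4)
    (trans (ℤ→ℚ-+ (+ m ℤ.* + m) (+ 4)) (cong (ℚ._+ ℤ→ℚ (+ 4)) (ℤ→ℚ-* (+ m) (+ m))))

  -- x + yε for ε = (m + √(m² + 4)) / 2.
  coords : ℚ → ℚ → K
  coords x y = (x ℚ.+ ½ ℚ.* (M ℚ.* y)) +√ (½ ℚ.* y)

  coords-injective : ∀ {x y x′ y′} → coords x y ≡ coords x′ y′ → x ≡ x′ × y ≡ y′
  coords-injective {x} {y} {x′} {y′} eq =
    trans (recover-x x y) (trans (cong (λ α → K.rat α ℚ.- M ℚ.* K.irr α) eq) (sym (recover-x x′ y′))) ,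
    trans (recover-y y) (trans (cong (λ α → K.irr α ℚ.+ K.irr α) eq) (sym (recover-y y′)))
    where
    open +-*-Solver
    recover-x : ∀ x y → x ≡ (x ℚ.+ ½ ℚ.* (M ℚ.* y)) ℚ.- M ℚ.* (½ ℚ.* y)
    recover-x x y = solve 3 (λ M x y → x := (x :+ con ½ :* (M :* y)) :- M :* (con ½ :* y)) refl M x y
    recover-y : ∀ y → y ≡ ½ ℚ.* y ℚ.+ ½ ℚ.* y
    recover-y = solve 1 (λ y → y := con ½ :* y :+ con ½ :* y) refl

  coords-+ : ∀ x y x′ y′ → coords x y ⊹ coords x′ y′ ≡ coords (x ℚ.+ x′) (y ℚ.+ y′)
  coords-+ x y x′ y′ = cong₂ _+√_
    (solve 5 (λ x y x′ y′ M → x :+ con ½ :* (M :* y) :+ (x′ :+ con ½ :* (M :* y′))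
       := x :+ x′ :+ con ½ :* (M :* (y :+ y′))) refl x y x′ y′ M)
    (sym (ℚ.*-distribˡ-+ ½ y y′))
    where open +-*-Solver

  -- Expresses ε² = m ε + 1, which enters by rewriting δ as M² + 4.
  coords-* : ∀ x y x′ y′ → coords x y ✶ coords x′ y′ ≡
    coords (x ℚ.* x′ ℚ.+ y ℚ.* y′) (x ℚ.* y′ ℚ.+ y ℚ.* x′ ℚ.+ M ℚ.* (y ℚ.* y′))
  coords-* x y x′ y′ = cong₂ _+√_
    (trans
      (cong (λ t → (x ℚ.+ ½ ℚ.* (M ℚ.* y)) ℚ.* (x′ ℚ.+ ½ ℚ.* (M ℚ.* y′))
                     ℚ.+ t ℚ.* (½ ℚ.* y ℚ.* (½ ℚ.* y′))) δ≡M²+4)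
      (solve 5 (λ x y x′ y′ M →
         (x :+ con ½ :* (M :* y)) :* (x′ :+ con ½ :* (M :* y′))
           :+ (M :* M :+ con (ℤ→ℚ (+ 4))) :* (con ½ :* y :* (con ½ :* y′))
         := x :* x′ :+ y :* y′ :+ con ½ :* (M :* (x :* y′ :+ y :* x′ :+ M :* (y :* y′))))
         refl x y x′ y′ M))
    (solve 5 (λ x y x′ y′ M →
       (x :+ con ½ :* (M :* y)) :* (con ½ :* y′) :+ con ½ :* y :* (x′ :+ con ½ :* (M :* y′))
       := con ½ :* (x :* y′ :+ y :* x′ :+ M :* (y :* y′))) refl x y x′ y′ M)
    where open +-*-Solver

  infix 5 _+ε_

  -- Opaque, since unfolding it makes the conversion checker normalise rationals.
  opaque
    _+ε_ : ℤ → ℤ → K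
    x +ε y = coords (ℤ→ℚ x) (ℤ→ℚ y)

    +ε-def : ∀ x y → x +ε y ≡ coords (ℤ→ℚ x) (ℤ→ℚ y)
    +ε-def x y = refl

  +ε-injective : ∀ {x y x′ y′} → x +ε y ≡ x′ +ε y′ → x ≡ x′ × y ≡ y′
  +ε-injective {x} {y} {x′} {y′} eq =
    ℤ→ℚ-injective {x} {x′} (proj₁ coords≡) , ℤ→ℚ-injective {y} {y′} (proj₂ coords≡)
    where
    coords≡ : ℤ→ℚ x ≡ ℤ→ℚ x′ × ℤ→ℚ y ≡ ℤ→ℚ y′
    coords≡ = coords-injective {ℤ→ℚ x} {ℤ→ℚ y} {ℤ→ℚ x′} {ℤ→ℚ y′}
      (trans (sym (+ε-def x y)) (trans eq (+ε-def x′ y′)))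

  0K≡ : 0K ≡ + 0 +ε + 0
  0K≡ = trans (cong (_+√ 0ℚ) (solve 1 (λ M → con 0ℚ := con 0ℚ :+ con ½ :* (M :* con 0ℚ)) refl M))
    (sym (+ε-def (+ 0) (+ 0)))
    where open +-*-Solver

  +ε-+ : ∀ x y x′ y′ → (x +ε y) ⊹ (x′ +ε y′) ≡ (x ℤ.+ x′) +ε (y ℤ.+ y′)
  +ε-+ x y x′ y′ = begin
    (x +ε y) ⊹ (x′ +ε y′)                                  ≡⟨ cong₂ _⊹_ (+ε-def x y) (+ε-def x′ y′) ⟩
    coords (ℤ→ℚ x) (ℤ→ℚ y) ⊹ coords (ℤ→ℚ x′) (ℤ→ℚ y′)      ≡⟨ coords-+ (ℤ→ℚ x) (ℤ→ℚ y) (ℤ→ℚ x′) (ℤ→ℚ y′) ⟩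
    coords (ℤ→ℚ x ℚ.+ ℤ→ℚ x′) (ℤ→ℚ y ℚ.+ ℤ→ℚ y′)           ≡⟨ cong₂ coords (ℤ→ℚ-+ x x′) (ℤ→ℚ-+ y y′) ⟨
    coords (ℤ→ℚ (x ℤ.+ x′)) (ℤ→ℚ (y ℤ.+ y′))               ≡⟨ +ε-def (x ℤ.+ x′) (y ℤ.+ y′) ⟨
    (x ℤ.+ x′) +ε (y ℤ.+ y′)                               ∎
    where open ≡-Reasoning

  +ε-* : ∀ x y x′ y′ → (x +ε y) ✶ (x′ +ε y′) ≡
         (x ℤ.* x′ ℤ.+ y ℤ.* y′) +ε (x ℤ.* y′ ℤ.+ y ℤ.* x′ ℤ.+ + m ℤ.* (y ℤ.* y′))
  +ε-* x y x′ y′ = begin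
    (x +ε y) ✶ (x′ +ε y′)                   ≡⟨ cong₂ _✶_ (+ε-def x y) (+ε-def x′ y′) ⟩
    coords X Y ✶ coords X′ Y′               ≡⟨ coords-* X Y X′ Y′ ⟩
    coords (X ℚ.* X′ ℚ.+ Y ℚ.* Y′) (X ℚ.* Y′ ℚ.+ Y ℚ.* X′ ℚ.+ M ℚ.* (Y ℚ.* Y′))
                                            ≡⟨ cong₂ coords ι₀ ι₁ ⟨
    coords (ℤ→ℚ x₀) (ℤ→ℚ x₁)                ≡⟨ +ε-def x₀ x₁ ⟨
    x₀ +ε x₁                                ∎
    where
    open ≡-Reasoning
    X  = ℤ→ℚ x
    Y  = ℤ→ℚ y
    X′ = ℤ→ℚ x′
    Y′ = ℤ→ℚ y′
    x₀ = x ℤ.* x′ ℤ.+ y ℤ.* y′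
    x₁ = x ℤ.* y′ ℤ.+ y ℤ.* x′ ℤ.+ + m ℤ.* (y ℤ.* y′)
    ι₀ : ℤ→ℚ x₀ ≡ X ℚ.* X′ ℚ.+ Y ℚ.* Y′
    ι₀ = trans (ℤ→ℚ-+ (x ℤ.* x′) (y ℤ.* y′)) (cong₂ ℚ._+_ (ℤ→ℚ-* x x′) (ℤ→ℚ-* y y′))
    ι₁ : ℤ→ℚ x₁ ≡ X ℚ.* Y′ ℚ.+ Y ℚ.* X′ ℚ.+ M ℚ.* (Y ℚ.* Y′)
    ι₁ = trans (ℤ→ℚ-+ (x ℤ.* y′ ℤ.+ y ℤ.* x′) (+ m ℤ.* (y ℤ.* y′))) (cong₂ ℚ._+_
      (trans (ℤ→ℚ-+ (x ℤ.* y′) (y ℤ.* x′)) (cong₂ ℚ._+_ (ℤ→ℚ-* x y′) (ℤ→ℚ-* y x′)))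
      (trans (ℤ→ℚ-* (+ m) (y ℤ.* y′)) (cong (M ℚ.*_) (ℤ→ℚ-* y y′))))

  -- (u + v√d) / 2 = (u - m v) / 2 + v ε, so evenness of u - m v is what places an integral element
  -- in ℤ[ε]. Substituting the hypothesis for u² makes every term of (u - m v)² even.
  parity : ∀ u v n → u ℤ.* u ≡ + (m ^ 2 + 4) ℤ.* (v ℤ.* v) ℤ.+ + 4 ℤ.* n →
           ∃ λ x → u ℤ.- + m ℤ.* v ≡ x ℤ.* + 2
  parity u v n eq = even-square⇒even (u ℤ.- + m ℤ.* v) k (begin
    (u ℤ.- + m ℤ.* v) ℤ.* (u ℤ.- + m ℤ.* v)
      ≡⟨ solve 3 (λ u v m → (u :- m :* v) :* (u :- m :* v)
           := u :* u :- m :* v :* (con (+ 2) :* u :- m :* v)) refl u v (+ m) ⟩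
    u ℤ.* u ℤ.- + m ℤ.* v ℤ.* (+ 2 ℤ.* u ℤ.- + m ℤ.* v)
      ≡⟨ cong (λ t → t ℤ.- + m ℤ.* v ℤ.* (+ 2 ℤ.* u ℤ.- + m ℤ.* v))
           (trans eq (cong (λ t → t ℤ.* (v ℤ.* v) ℤ.+ + 4 ℤ.* n) +d≡m²+4)) ⟩
    (+ m ℤ.* + m ℤ.+ + 4) ℤ.* (v ℤ.* v) ℤ.+ + 4 ℤ.* n ℤ.- + m ℤ.* v ℤ.* (+ 2 ℤ.* u ℤ.- + m ℤ.* v)
      ≡⟨ solve 4 (λ u v m n →
           (m :* m :+ con (+ 4)) :* (v :* v) :+ con (+ 4) :* n :- m :* v :* (con (+ 2) :* u :- m :* v)
           := (m :* v :* (m :* v) :+ con (+ 2) :* (v :* v) :+ con (+ 2) :* n :- m :* v :* u) :* con (+ 2))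
           refl u v (+ m) n ⟩
    k ℤ.* + 2 ∎)
    where
    open ≡-Reasoning
    open ℤ-Solver
    k : ℤ
    k = + m ℤ.* v ℤ.* (+ m ℤ.* v) ℤ.+ + 2 ℤ.* (v ℤ.* v) ℤ.+ + 2 ℤ.* n ℤ.- + m ℤ.* v ℤ.* u

  half-integers⇒+ε : ∀ {a b u v} x → a ℚ.+ a ≡ ℤ→ℚ u → b ℚ.+ b ≡ ℤ→ℚ v →
                     u ℤ.- + m ℤ.* v ≡ x ℤ.* + 2 → a +√ b ≡ x +ε v
  half-integers⇒+ε {a} {b} {u} {v} x 2a≡u 2b≡v u-mv≡2x =
    trans (cong₂ _+√_ a≡ b≡) (sym (+ε-def x v))
    where
    open ≡-Reasoning
    open +-*-Solver
    halve : ∀ q → q ≡ ½ ℚ.* (q ℚ.+ q)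
    halve = solve 1 (λ q → q := con ½ :* (q :+ q)) refl
    u≡2x+mv : u ≡ x ℤ.* + 2 ℤ.+ + m ℤ.* v
    u≡2x+mv = trans (ℤ-Solver.solve 2 (λ u w → u ℤ-Solver.:= (u ℤ-Solver.:- w) ℤ-Solver.:+ w) refl u (+ m ℤ.* v))
      (cong (ℤ._+ + m ℤ.* v) u-mv≡2x)
    ι-u : ℤ→ℚ u ≡ ℤ→ℚ x ℚ.* ℤ→ℚ (+ 2) ℚ.+ M ℚ.* ℤ→ℚ v
    ι-u = trans (cong ℤ→ℚ u≡2x+mv)
      (trans (ℤ→ℚ-+ (x ℤ.* + 2) (+ m ℤ.* v)) (cong₂ ℚ._+_ (ℤ→ℚ-* x (+ 2)) (ℤ→ℚ-* (+ m) v)))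
    a≡ : a ≡ ℤ→ℚ x ℚ.+ ½ ℚ.* (M ℚ.* ℤ→ℚ v)
    a≡ = begin
      a                                               ≡⟨ halve a ⟩
      ½ ℚ.* (a ℚ.+ a)                                 ≡⟨ cong (λ t → ½ ℚ.* t) (trans 2a≡u ι-u) ⟩
      ½ ℚ.* (ℤ→ℚ x ℚ.* ℤ→ℚ (+ 2) ℚ.+ M ℚ.* ℤ→ℚ v)
        ≡⟨ solve 3 (λ x M v → con ½ :* (x :* con (ℤ→ℚ (+ 2)) :+ M :* v) := x :+ con ½ :* (M :* v)) refl (ℤ→ℚ x) M (ℤ→ℚ v) ⟩
      ℤ→ℚ x ℚ.+ ½ ℚ.* (M ℚ.* ℤ→ℚ v)                   ∎
    b≡ : b ≡ ½ ℚ.* ℤ→ℚ v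
    b≡ = trans (halve b) (cong (λ t → ½ ℚ.* t) 2b≡v)

  integral⇒+ε : SquareFree (m ^ 2 + 4) → ∀ {α} → Integral α → ∃₂ λ x y → α ≡ x +ε y
  integral⇒+ε sf {a +√ b} int =
    let u , v , n , 2a≡u , 2b≡v , u²≡ = integral⇒half-integers sf {a} {b} int
        x , u-mv≡2x = parity u v n u²≡
    in x , v , half-integers⇒+ε {a} {b} {u} {v} x 2a≡u 2b≡v u-mv≡2x

  +-identityʳ : ∀ α → α ⊹ 0K ≡ α
  +-identityʳ (a +√ b) = cong₂ _+√_ (ℚ.+-identityʳ a) (ℚ.+-identityʳ b)

  +ε-*-0K : ∀ x y x′ y′ → (x +ε y) ✶ (x′ +ε y′) ⊹ 0K ≡
    (x ℤ.* x′ ℤ.+ y ℤ.* y′) +ε (x ℤ.* y′ ℤ.+ y ℤ.* x′ ℤ.+ + m ℤ.* (y ℤ.* y′))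
  +ε-*-0K x y x′ y′ = trans (+-identityʳ ((x +ε y) ✶ (x′ +ε y′))) (+ε-* x y x′ y′)

  combination : ∀ p r₀ r₁ s₀ s₁ → ∃₂ λ x y →
    (r₀ +ε r₁) ✶ (+ p +ε + 0) ⊹ ((s₀ +ε s₁) ✶ (-[1+ 0 ] +ε + 1) ⊹ 0K) ≡ x +ε y
  combination p r₀ r₁ s₀ s₁ =
    (r₀ ℤ.* + p ℤ.+ r₁ ℤ.* + 0) ℤ.+ (s₀ ℤ.* -[1+ 0 ] ℤ.+ s₁ ℤ.* + 1) ,
    (r₀ ℤ.* + 0 ℤ.+ r₁ ℤ.* + p ℤ.+ + m ℤ.* (r₁ ℤ.* + 0))
      ℤ.+ (s₀ ℤ.* + 1 ℤ.+ s₁ ℤ.* -[1+ 0 ] ℤ.+ + m ℤ.* (s₁ ℤ.* + 1)) ,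
    trans (cong₂ _⊹_ (+ε-* r₀ r₁ (+ p) (+ 0)) (+ε-*-0K s₀ s₁ -[1+ 0 ] (+ 1)))
      (+ε-+ (r₀ ℤ.* + p ℤ.+ r₁ ℤ.* + 0)
            (r₀ ℤ.* + 0 ℤ.+ r₁ ℤ.* + p ℤ.+ + m ℤ.* (r₁ ℤ.* + 0))
            (s₀ ℤ.* -[1+ 0 ] ℤ.+ s₁ ℤ.* + 1)
            (s₀ ℤ.* + 1 ℤ.+ s₁ ℤ.* -[1+ 0 ] ℤ.+ + m ℤ.* (s₁ ℤ.* + 1)))

  integral-0K : Integral 0K
  integral-0K = + 0 ∷ [] , cong₂ _+√_ (solve 1 (λ δ → con 0ℚ :+ (con 0ℚ :* con 1ℚ :+ δ :* (con 0ℚ :* con 0ℚ)) := con 0ℚ) refl δ) refl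
    where open +-*-Solver

  integral-1K : Integral 1K
  integral-1K = -[1+ 0 ] ∷ [] , cong₂ _+√_ (solve 1 (λ δ → con (ℤ→ℚ -[1+ 0 ]) :+ (con 1ℚ :* con 1ℚ :+ δ :* (con 0ℚ :* con 0ℚ)) := con 0ℚ) refl δ) refl
    where open +-*-Solver

  -- If γ = x + yε generates the ideal (p, ε − 1), where p ∣ m, then p = μγ and
  -- ε − 1 = νγ give det(ν, μ) · N(γ) = p, while γ ∈ (p, ε − 1) gives p ∣ N(γ).
  generator-norm : ∀ {p} → p ∣ m → ∀ x y r₀ r₁ s₀ s₁ m₀ m₁ n₀ n₁ →
    x +ε y ≡ (r₀ +ε r₁) ✶ (+ p +ε + 0) ⊹ ((s₀ +ε s₁) ✶ (-[1+ 0 ] +ε + 1) ⊹ 0K) →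
    + p +ε + 0 ≡ (m₀ +ε m₁) ✶ (x +ε y) ⊹ 0K →
    -[1+ 0 ] +ε + 1 ≡ (n₀ +ε n₁) ✶ (x +ε y) ⊹ 0K →
    ∣ Q x y ∣ ≡ p
  generator-norm {p} (divides l m≡lp) x y r₀ r₁ s₀ s₁ m₀ m₁ n₀ n₁ γ≡ p≡ ε-1≡ =
    ℕ.∣-antisym
      (divides (∣ n₁ ℤ.* m₀ ℤ.- n₀ ℤ.* m₁ ∣) (trans (cong ∣_∣ (sym det*Q)) (ℤ.abs-* (n₁ ℤ.* m₀ ℤ.- n₀ ℤ.* m₁) (Q x y))))
      (divides (∣ k ∣) (trans (cong ∣_∣ Q≡kp) (ℤ.abs-* k (+ p))))
    where
    open ≡-Reasoning
    open ℤ-Solver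
    μγ : + p ≡ m₀ ℤ.* x ℤ.+ m₁ ℤ.* y × + 0 ≡ m₀ ℤ.* y ℤ.+ m₁ ℤ.* x ℤ.+ + m ℤ.* (m₁ ℤ.* y)
    μγ = +ε-injective (trans p≡ (+ε-*-0K m₀ m₁ x y))
    νγ : -[1+ 0 ] ≡ n₀ ℤ.* x ℤ.+ n₁ ℤ.* y × + 1 ≡ n₀ ℤ.* y ℤ.+ n₁ ℤ.* x ℤ.+ + m ℤ.* (n₁ ℤ.* y)
    νγ = +ε-injective (trans ε-1≡ (+ε-*-0K n₀ n₁ x y))
    det*Q : (n₁ ℤ.* m₀ ℤ.- n₀ ℤ.* m₁) ℤ.* Q x y ≡ + p
    det*Q = begin
      (n₁ ℤ.* m₀ ℤ.- n₀ ℤ.* m₁) ℤ.* Q x y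
        ≡⟨ solve 7 (λ m x y m₀ m₁ n₀ n₁ →
             (n₁ :* m₀ :- n₀ :* m₁) :* (x :* x :+ m :* x :* y :- y :* y)
             := (m₀ :* x :+ m₁ :* y) :* (n₀ :* y :+ n₁ :* x :+ m :* (n₁ :* y))
                :- (m₀ :* y :+ m₁ :* x :+ m :* (m₁ :* y)) :* (n₀ :* x :+ n₁ :* y))
             refl (+ m) x y m₀ m₁ n₀ n₁ ⟩
      (m₀ ℤ.* x ℤ.+ m₁ ℤ.* y) ℤ.* (n₀ ℤ.* y ℤ.+ n₁ ℤ.* x ℤ.+ + m ℤ.* (n₁ ℤ.* y))
        ℤ.- (m₀ ℤ.* y ℤ.+ m₁ ℤ.* x ℤ.+ + m ℤ.* (m₁ ℤ.* y)) ℤ.* (n₀ ℤ.* x ℤ.+ n₁ ℤ.* y)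
        ≡⟨ cong₂ ℤ._-_ (cong₂ ℤ._*_ (proj₁ μγ) (proj₂ νγ)) (cong₂ ℤ._*_ (proj₂ μγ) (proj₁ νγ)) ⟨
      + p ℤ.* + 1 ℤ.- + 0 ℤ.* -[1+ 0 ]
        ≡⟨ solve 1 (λ p → p :* con (+ 1) :- con (+ 0) :* con -[1+ 0 ] := p) refl (+ p) ⟩
      + p ∎
    a b : ℤ
    a = proj₁ (combination p r₀ r₁ s₀ s₁)
    b = proj₁ (proj₂ (combination p r₀ r₁ s₀ s₁))
    γ-components : x ≡ a × y ≡ b
    γ-components = +ε-injective (trans γ≡ (proj₂ (proj₂ (combination p r₀ r₁ s₀ s₁))))
    L = + l
    -- Q x y = (x + y)(x - y) + m x y, and p divides both x + y and m; `k` collects the two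
    -- quotients.
    k : ℤ
    k = (r₀ ℤ.+ r₁ ℤ.+ L ℤ.* s₁) ℤ.* (x ℤ.- y) ℤ.+ L ℤ.* x ℤ.* y
    +m≡Lp : + m ≡ L ℤ.* + p
    +m≡Lp = trans (cong +_ m≡lp) (ℤ.pos-* l p)
    -- Sending ε to 1 is a ring map from ℤ[ε] to ℤ/p because p ∣ m. It kills p and ε - 1, hence also
    -- γ.
    x+y≡ : x ℤ.+ y ≡ (r₀ ℤ.+ r₁ ℤ.+ L ℤ.* s₁) ℤ.* + p
    x+y≡ = begin
      x ℤ.+ y ≡⟨ cong₂ ℤ._+_ (proj₁ γ-components) (proj₂ γ-components) ⟩
      a ℤ.+ b ≡⟨ solve 6 (λ r₀ r₁ s₀ s₁ m p →
          r₀ :* p :+ r₁ :* con (+ 0) :+ (s₀ :* con -[1+ 0 ] :+ s₁ :* con (+ 1))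
          :+ (r₀ :* con (+ 0) :+ r₁ :* p :+ m :* (r₁ :* con (+ 0))
              :+ (s₀ :* con (+ 1) :+ s₁ :* con -[1+ 0 ] :+ m :* (s₁ :* con (+ 1))))
          := (r₀ :+ r₁) :* p :+ m :* s₁) refl r₀ r₁ s₀ s₁ (+ m) (+ p) ⟩
      (r₀ ℤ.+ r₁) ℤ.* + p ℤ.+ + m ℤ.* s₁ ≡⟨ cong (λ t → (r₀ ℤ.+ r₁) ℤ.* + p ℤ.+ t ℤ.* s₁) +m≡Lp ⟩
      (r₀ ℤ.+ r₁) ℤ.* + p ℤ.+ L ℤ.* + p ℤ.* s₁
        ≡⟨ solve 5 (λ r₀ r₁ s₁ L p → (r₀ :+ r₁) :* p :+ L :* p :* s₁ := (r₀ :+ r₁ :+ L :* s₁) :* p) refl r₀ r₁ s₁ L (+ p) ⟩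
      (r₀ ℤ.+ r₁ ℤ.+ L ℤ.* s₁) ℤ.* + p ∎
    Q≡kp : Q x y ≡ k ℤ.* + p
    Q≡kp = begin
      Q x y
        ≡⟨ solve 3 (λ m x y → x :* x :+ m :* x :* y :- y :* y := (x :+ y) :* (x :- y) :+ m :* x :* y) refl (+ m) x y ⟩
      (x ℤ.+ y) ℤ.* (x ℤ.- y) ℤ.+ + m ℤ.* x ℤ.* y
        ≡⟨ cong₂ (λ s t → s ℤ.* (x ℤ.- y) ℤ.+ t ℤ.* x ℤ.* y) x+y≡ +m≡Lp ⟩
      (r₀ ℤ.+ r₁ ℤ.+ L ℤ.* s₁) ℤ.* + p ℤ.* (x ℤ.- y) ℤ.+ L ℤ.* + p ℤ.* x ℤ.* y
        ≡⟨ solve 5 (λ e L p x y → e :* p :* (x :- y) :+ L :* p :* x :* y := (e :* (x :- y) :+ L :* x :* y) :* p)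
             refl (r₀ ℤ.+ r₁ ℤ.+ L ℤ.* s₁) L (+ p) x y ⟩
      k ℤ.* + p ∎

  -- From class number one to an element of norm ±p

  classNumber≡1⇒equivalent : ClassNumber (m ^ 2 + 4) 1 → ∀ I J → I ∼ J
  classNumber≡1⇒equivalent h≡1 I J = ∼-trans {I} {to (from I)} {J}
    (∼-sym {to (from I)} {I} (strictlyInverseˡ I))
    (subst (λ i → to i ∼ J) (Fin1-prop (from J) (from I)) (strictlyInverseˡ J))
    where
    open Inverse h≡1
    Fin1-prop : (i j : Fin 1) → i ≡ j
    Fin1-prop zero zero = refl

  unitIdeal : FractionalIdeal
  unitIdeal = ⟨ 1K ∷ [] , here (λ ()) ⟩

  -- When p ∣ m, X² - m X - 1 ≡ (X - 1)(X + 1) modulo p, which is where the second generator ε - 1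
  -- comes from.
  primeIdeal : ∀ {p} → Prime p → FractionalIdeal
  primeIdeal {p} p-prime = ⟨ (+ p +ε + 0) ∷ (-[1+ 0 ] +ε + 1) ∷ [] , here p≢0 ⟩
    where
    p≢0 : + p +ε + 0 ≢ 0K
    p≢0 eq = ¬prime[0] (subst Prime (ℤ.+-injective (proj₁ p≡0)) p-prime)
      where
      p≡0 : + p ≡ + 0 × + 0 ≡ + 0
      p≡0 = +ε-injective (trans eq 0K≡)

  -- Equivalence with the unit ideal makes (p, ε - 1) principal. The mutual memberships of the
  -- generators give three equations with integral coefficients; rewritten in the basis 1, ε they
  -- are the input of `generator-norm`.
  prime∣m⇒norm : SquareFree (m ^ 2 + 4) → ClassNumber (m ^ 2 + 4) 1 → ∀ {p} → Prime p → p ∣ m →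
                 ∃₂ λ x y → ∣ Q x y ∣ ≡ p
  prime∣m⇒norm sf h≡1 {p} p-prime p∣m = conclude
    (Equivalence.to (γ≈P γ) (1K , 0K , integral-1K , refl , sym (one-times γ)))
    (Equivalence.from (γ≈P g₁) (1K , 0K ✶ g₂ ⊹ 0K , integral-1K , (0K , 0K , integral-0K , refl , refl) , g₁≡))
    (Equivalence.from (γ≈P g₂) (0K , 1K ✶ g₂ ⊹ 0K , integral-0K , (1K , 0K , integral-1K , refl , refl) , g₂≡))
    where
    equivalent : unitIdeal ∼ primeIdeal p-prime
    equivalent = classNumber≡1⇒equivalent h≡1 unitIdeal (primeIdeal p-prime)
    γ g₁ g₂ : K
    γ = Kˣ.value (proj₁ equivalent) ✶ 1K
    g₁ = + p +ε + 0
    g₂ = -[1+ 0 ] +ε + 1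
    γ≈P : ∀ α → α ∈⟨ γ ∷ [] ⟩ ⇔ α ∈⟨ g₁ ∷ g₂ ∷ [] ⟩
    γ≈P = proj₂ equivalent
    one-times : ∀ α → 1K ✶ α ⊹ 0K ≡ α
    one-times α = trans (+-identityʳ (1K ✶ α)) (*-identityˡ α)
    0K-times : ∀ α → 0K ✶ α ≡ 0K
    0K-times α = trans (*-comm 0K α) (*-zeroʳ α)
    g₁≡ : g₁ ≡ 1K ✶ g₁ ⊹ (0K ✶ g₂ ⊹ 0K)
    g₁≡ = trans (sym (one-times g₁)) (cong (λ t → 1K ✶ g₁ ⊹ t)
      (sym (trans (+-identityʳ (0K ✶ g₂)) (0K-times g₂))))
    g₂≡ : g₂ ≡ 0K ✶ g₁ ⊹ (1K ✶ g₂ ⊹ 0K)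
    g₂≡ = trans (sym (one-times g₂)) (trans (sym (+-identityˡ (1K ✶ g₂ ⊹ 0K)))
      (cong (λ t → t ⊹ (1K ✶ g₂ ⊹ 0K)) (sym (0K-times g₁))))
    conclude : γ ∈⟨ g₁ ∷ g₂ ∷ [] ⟩ → g₁ ∈⟨ γ ∷ [] ⟩ → g₂ ∈⟨ γ ∷ [] ⟩ → ∃₂ λ x y → ∣ Q x y ∣ ≡ p
    conclude (ρ , _ , ρ-int , (σ , _ , σ-int , refl , refl) , γ≡) (μ , _ , μ-int , refl , g₁≡) (ν , _ , ν-int , refl , g₂≡) =
      let r₀ , r₁ , ρ≡ = integral⇒+ε sf ρ-int
          s₀ , s₁ , σ≡ = integral⇒+ε sf σ-int
          m₀ , m₁ , μ≡ = integral⇒+ε sf μ-int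
          n₀ , n₁ , ν≡ = integral⇒+ε sf ν-int
          -- Nothing is known about γ beyond its membership in (p, ε - 1); its integer coordinates
          -- come from those of the coefficients ρ and σ.
          γ≡′ = trans γ≡ (cong₂ (λ ρ σ → ρ ✶ g₁ ⊹ (σ ✶ g₂ ⊹ 0K)) ρ≡ σ≡)
          x , y , γ≡xy = combination p r₀ r₁ s₀ s₁
      in x , y , generator-norm p∣m x y r₀ r₁ s₀ s₁ m₀ m₁ n₀ n₁
           (sym γ≡xy)
           (trans g₁≡ (cong₂ (λ μ γ → μ ✶ γ ⊹ 0K) μ≡ (trans γ≡′ γ≡xy)))
           (trans g₂≡ (cong₂ (λ ν γ → ν ✶ γ ⊹ 0K) ν≡ (trans γ≡′ γ≡xy)))

-- Composite m contradicts class number one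

small-prime-¬norm : ∀ {m p} → Prime p → p ℕ.< m → ¬ (∃₂ λ x y → ∣ NormForm.Q m x y ∣ ≡ p)
small-prime-¬norm {m} p-prime p<m (x , y , |Q|≡p) =
  prime⇒¬square p-prime (NormForm.small-norm-isSquare m p<m x y |Q|≡p)

classNumber≡1⇒¬composite : ∀ m → SquareFree (m ^ 2 + 4) → ClassNumber (m ^ 2 + 4) 1 → ¬ Composite m
classNumber≡1⇒¬composite m sf h≡1 m-composite = go (composite⇒properPrimeDivisor m-composite)
  where
  go : ¬ (∃ λ p → Prime p × p ℕ.< m × p ∣ m)
  go (p , p-prime , p<m , p∣m) =
    small-prime-¬norm p-prime p<m (EpsilonBasis.prime∣m⇒norm m sf h≡1 p-prime p∣m)

theorem1p4 : ∀ (m : ℕ) → m > 0 → SquareFree (m ^ 2 + 4) → ClassNumber (m ^ 2 + 4) 1 → m ≡ 1 ⊎ Prime m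
theorem1p4 1             _ _  _   = inj₁ refl
theorem1p4 (suc (suc k)) _ sf h≡1 = inj₂ (¬composite⇒prime (classNumber≡1⇒¬composite (suc (suc k)) sf h≡1))
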